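{- For every positive integer $n$ there exists a constant $c(n)>0$, depending only on $n$, such that the following holds for every finite field $\mathbb{F}_q$. For all $A, B, C\subseteq M_n(\mathbb{F}_q)$, $$ |A+BC|\geq c(n)\min\left\{q^{n^2}, \frac{|A||B||C|}{q^{2n^2-\frac{n+1}{2}}}\right\}. $$ In particular, for every constant $K>0$ there is a constant $c'(n,K)>0$ (independent of $q$) such that if $|A||B||C|\geq K q^{3n^2-\frac{n+1}{2}}$, then $|A+BC|\geq c'(n,K) q^{n^2}$.
   Context: $\mathbb{F}_q$ denotes the finite field with $q$ elements and $M_n(\mathbb{F}_q)$ the ring of $n\times n$ matrices over $\mathbb{F}_q$. For $A,B\subseteq M_n(\mathbb{F}_q)$, $A+B=\{a+b:a\in A,b\in B\}$ and $BC=\{bc:b\in B,c\in C\}$, so $A+BC=\{a+bc: a\in A, b\in B, c\in C\}$. The paper writes $X\gtrsim Y$ to mean $X\geq c\,Y$ for some constant $c>0$ that may depend on $n$ but not on $q$; the claim above spells this out. -}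

module Defs where

open import Level using (0ℓ)
open import Data.Nat using (ℕ; zero; suc)
open import Data.Bool using (Bool; _∧_; true; false)
open import Data.Fin using (Fin)
open import Data.Vec using (Vec; []; _∷_; lookup; tabulate)
import Data.Vec.Properties as VecP
open import Data.List using (List; []; _∷_; length; map; concatMap; foldr; filterᵇ; allFin)
open import Data.Bool.ListAction using (any)
open import Data.List.Membership.Propositional using (_∈_)
open import Data.List.Relation.Unary.Unique.Propositional using (Unique)
open import Data.Product using (∃)
open import Relation.Binary.PropositionalEquality using (_≡_; _≢_)
open import Relation.Binary.Definitions using (DecidableEquality)
open import Relation.Nullary using (does)
open import Algebra.Core using (Op₁; Op₂)
open import Algebra.Structures using (IsCommutativeRing)

record FiniteField : Set₁ where
  field
    Carrier   : Set
    _+_ _*_   : Op₂ Carrier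
    -_        : Op₁ Carrier
    0# 1#     : Carrier
    isCommutativeRing : IsCommutativeRing _≡_ _+_ _*_ -_ 0# 1#
    0≢1       : 0# ≢ 1#
    inverse   : ∀ x → x ≢ 0# → ∃ λ y → x * y ≡ 1#
    _≟_       : DecidableEquality Carrier
    elements  : List Carrier
    complete  : ∀ x → x ∈ elements
    unique    : Unique elements

  size : ℕ
  size = length elements

module _ (F : FiniteField) where
  open FiniteField F

  Matrix : ℕ → Set
  Matrix n = Vec (Vec Carrier n) n

  _+ᴹ_ : ∀ {n} → Matrix n → Matrix n → Matrix n
  _+ᴹ_ {n} M N = tabulate λ i → tabulate λ j → lookup (lookup M i) j + lookup (lookup N i) j

  _*ᴹ_ : ∀ {n} → Matrix n → Matrix n → Matrix n
  _*ᴹ_ {n} M N = tabulate λ i → tabulate λ j →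
    foldr _+_ 0# (map (λ k → lookup (lookup M i) k * lookup (lookup N k) j) (allFin n))

  _≟ᴹ_ : ∀ {n} → DecidableEquality (Matrix n)
  _≟ᴹ_ = VecP.≡-dec (VecP.≡-dec _≟_)

  allVecs : ∀ {A : Set} → List A → (m : ℕ) → List (Vec A m)
  allVecs xs zero    = [] ∷ []
  allVecs xs (suc m) = concatMap (λ x → map (x ∷_) (allVecs xs m)) xs

  allMatrices : ∀ n → List (Matrix n)
  allMatrices n = allVecs (allVecs elements n) n

  MSubset : ℕ → Set
  MSubset n = Matrix n → Bool

  card : ∀ {n} → MSubset n → ℕ
  card {n} S = length (filterᵇ S (allMatrices n))

  sumProd : ∀ {n} → MSubset n → MSubset n → MSubset n → MSubset n
  sumProd {n} A B C M =
    any (λ a → any (λ b → any (λ c →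
      A a ∧ B b ∧ C c ∧ does (M ≟ᴹ (a +ᴹ (b *ᴹ c))))
      (allMatrices n)) (allMatrices n)) (allMatrices n)

{-# OPTIONS --safe #-}
module Submission where

-- Write Q = q^(n²), S = A + BC, and let g = Q·1_A − |A|, which has total 0. Put
-- conv c s = Σ_{b ∈ B} g(s − bc), so that Σ_{c ∈ C} Σ_{s ∈ S} conv c s = |A||B||C| (Q − |S|).
-- The second moment of conv is controlled without characters: the Radon transform
-- R f t v = Σ_{⟨t,s⟩ = v} f(s) for the Frobenius pairing satisfies a Plancherel identity on
-- functions of total 0. For fixed t ≠ 0 one has ⟨t, bc⟩ = ⟨bᵀt, c⟩; averaging over c kills the
-- pairs b, b′ with bᵀt ≠ b′ᵀt, and at most Q / qⁿ matrices b′ share the value bᵀt. Hence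
-- qⁿ Σ_{c,s} (conv c s)² ≤ Q⁴ |A||B|, and Cauchy–Schwarz gives |S| > Q/2 or
-- qⁿ |A||B||C| ≤ 4 Q² |S|. This is stronger than required since 2n ≥ n + 1.

open import Defs hiding (_+ᴹ_; _*ᴹ_; _≟ᴹ_)
open import Algebra.Bundles using (CommutativeRing; module CommutativeMonoid)
open import Algebra.Core using (Op₁; Op₂)
open import Algebra.Structures using (IsCommutativeRing)
open import Data.Bool using (Bool; true; false; T; if_then_else_)
open import Data.Bool.Properties using (T-≡; T-∧)
open import Data.Fin using (Fin)
import Data.Fin.Properties as Fin
import Data.Integer as ℤ
import Data.Integer.Properties as ℤ
open import Data.Integer.Tactic.RingSolver using (solve-∀)
open import Data.List using (List; []; _∷_; _++_; length; map; foldr; concatMap; filterᵇ; allFin)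
import Data.List.Membership.DecPropositional as DecMembership
open import Data.List.Membership.Propositional using (_∈_; _∉_; lose)
open import Data.List.Membership.Propositional.Properties using (∈-allFin)
open import Data.List.Properties using (length-++; length-map)
import Data.List.Relation.Unary.All as All
open import Data.List.Relation.Unary.AllPairs using (_∷_)
open import Data.List.Relation.Unary.Any using (here; there)
open import Data.List.Relation.Unary.Any.Properties using (any⁺)
open import Data.List.Relation.Unary.Unique.Propositional using (Unique)
open import Data.List.Relation.Unary.Unique.Propositional.Properties using (allFin⁺)
open import Data.Nat as ℕ using (ℕ; zero; suc; z≤n)
import Data.Nat.Properties as ℕ
open import Data.Nat.Tactic.RingSolver using () renaming (solve-∀ to ℕ-solve-∀)
open import Data.Product using (∃; _,_)
import Data.Rational as ℚ
import Data.Rational.Properties as ℚ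
import Data.Rational.Unnormalised as ℚᵘ
import Data.Rational.Unnormalised.Properties as ℚᵘ
open import Data.Sum as Sum using (inj₁; inj₂)
open import Data.Vec using (Vec; []; _∷_; lookup; tabulate)
open import Data.Vec.Properties using (lookup∘tabulate; tabulate-cong; tabulate∘lookup)
open import Function.Bundles using (Equivalence)
open import Relation.Binary.Definitions using (DecidableEquality)
open import Relation.Binary.PropositionalEquality
  using (_≡_; _≢_; refl; sym; trans; cong; cong₂; subst; subst₂; module ≡-Reasoning)
open import Relation.Nullary using (Dec; does; ¬_; yes; no; contradiction)
open import Relation.Nullary.Decidable using (dec-true; dec-false)

-- Additive characters would force roots of unity into the argument; level-set sums keep every
-- quantity an integer. Division is avoided as well: `g` is `Q` times the balanced function of A,
-- and identities carry factors `q`, `qⁿ` or `Q` until these can be cancelled. Total 0 plays the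
-- part of discarding the trivial character. It removes the constant term of the Plancherel
-- identity, and it makes the transform vanish at t = 0, the one matrix for which all bᵀt coincide
-- and no fibre bound is available. The second moment runs over all matrices c, although only those
-- in C matter. Cauchy-Schwarz makes this enlargement free, and a complete sum over c is what
-- equidistributes ⟨bᵀt - b′ᵀt, c⟩. The saving qⁿ comes from a single nonzero row of t: changing the
-- matching row of b in its qⁿ possible ways changes bᵀt every time.

-- Finite sums over a commutative ring, used both for the integers and for the field.

module Summation {R : Set} {_+_ _*_ : Op₂ R} { -_ : Op₁ R} {0# 1# : R}
  (isCommutativeRing : IsCommutativeRing _≡_ _+_ _*_ -_ 0# 1#) where

  private
    commutativeRing : CommutativeRing _ _
    commutativeRing = record { isCommutativeRing = isCommutativeRing }

  open CommutativeRing commutativeRing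
    using (+-identityˡ; +-identityʳ; +-assoc; distribˡ; zeroʳ; *-comm;
           +-commutativeSemigroup; *-commutativeSemigroup)
  open import Algebra.Properties.CommutativeSemigroup +-commutativeSemigroup using () renaming (interchange to +-medial)
  open import Algebra.Properties.CommutativeSemigroup *-commutativeSemigroup using () renaming (interchange to *-medial)
  open ≡-Reasoning

  ∑ : {X : Set} → List X → (X → R) → R
  ∑ xs f = foldr _+_ 0# (map f xs)

  module _ {X : Set} where

    ∑-cong : (xs : List X) {f g : X → R} → (∀ x → f x ≡ g x) → ∑ xs f ≡ ∑ xs g
    ∑-cong []       f≡g = refl
    ∑-cong (x ∷ xs) f≡g = cong₂ _+_ (f≡g x) (∑-cong xs f≡g)

    ∑-zero : (xs : List X) {f : X → R} → (∀ x → f x ≡ 0#) → ∑ xs f ≡ 0#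
    ∑-zero []       f≡0 = refl
    ∑-zero (x ∷ xs) f≡0 = trans (cong₂ _+_ (f≡0 x) (∑-zero xs f≡0)) (+-identityˡ 0#)

    ∑-+ : (xs : List X) (f g : X → R) → ∑ xs (λ x → f x + g x) ≡ ∑ xs f + ∑ xs g
    ∑-+ []       f g = sym (+-identityˡ 0#)
    ∑-+ (x ∷ xs) f g = trans (cong ((f x + g x) +_) (∑-+ xs f g)) (+-medial (f x) (g x) (∑ xs f) (∑ xs g))

    ∑-*ˡ : (xs : List X) (k : R) (f : X → R) → ∑ xs (λ x → k * f x) ≡ k * ∑ xs f
    ∑-*ˡ []       k f = sym (zeroʳ k)
    ∑-*ˡ (x ∷ xs) k f = trans (cong ((k * f x) +_) (∑-*ˡ xs k f)) (sym (distribˡ k (f x) (∑ xs f)))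

    ∑-*ʳ : (xs : List X) (k : R) (f : X → R) → ∑ xs (λ x → f x * k) ≡ ∑ xs f * k
    ∑-*ʳ xs k f = begin
      ∑ xs (λ x → f x * k)  ≡⟨ ∑-cong xs (λ x → *-comm (f x) k) ⟩
      ∑ xs (λ x → k * f x)  ≡⟨ ∑-*ˡ xs k f ⟩
      k * ∑ xs f            ≡⟨ *-comm k (∑ xs f) ⟩
      ∑ xs f * k            ∎

    ∑-++ : (xs ys : List X) (f : X → R) → ∑ (xs ++ ys) f ≡ ∑ xs f + ∑ ys f
    ∑-++ []       ys f = sym (+-identityˡ (∑ ys f))
    ∑-++ (x ∷ xs) ys f = trans (cong (f x +_) (∑-++ xs ys f)) (sym (+-assoc (f x) (∑ xs f) (∑ ys f)))

  module _ {X Y : Set} where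

    ∑-swap : (xs : List X) (ys : List Y) (f : X → Y → R) →
             ∑ xs (λ x → ∑ ys (f x)) ≡ ∑ ys (λ y → ∑ xs (λ x → f x y))
    ∑-swap []       ys f = sym (∑-zero ys (λ _ → refl))
    ∑-swap (x ∷ xs) ys f =
      trans (cong (∑ ys (f x) +_) (∑-swap xs ys f)) (sym (∑-+ ys (f x) (λ y → ∑ xs (λ x′ → f x′ y))))

    ∑-product : (xs : List X) (ys : List Y) (f : X → R) (g : Y → R) →
                ∑ xs f * ∑ ys g ≡ ∑ xs (λ x → ∑ ys (λ y → f x * g y))
    ∑-product xs ys f g = begin
      ∑ xs f * ∑ ys g                        ≡⟨ ∑-*ʳ xs (∑ ys g) f ⟨
      ∑ xs (λ x → f x * ∑ ys g)              ≡⟨ ∑-cong xs (λ x → ∑-*ˡ ys (f x) g) ⟨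
      ∑ xs (λ x → ∑ ys (λ y → f x * g y))    ∎

    ∑-map : (h : X → Y) (xs : List X) (f : Y → R) → ∑ (map h xs) f ≡ ∑ xs (λ x → f (h x))
    ∑-map h []       f = refl
    ∑-map h (x ∷ xs) f = cong (f (h x) +_) (∑-map h xs f)

    ∑-concatMap : (h : X → List Y) (xs : List X) (f : Y → R) → ∑ (concatMap h xs) f ≡ ∑ xs (λ x → ∑ (h x) f)
    ∑-concatMap h []       f = refl
    ∑-concatMap h (x ∷ xs) f =
      trans (∑-++ (h x) (concatMap h xs) f) (cong (∑ (h x) f +_) (∑-concatMap h xs f))

  module _ {X Y : Set} where

    -- Opening the square and summing over `z` first turns a second moment into correlations of
    -- pairs of kernels. Both the Plancherel identity and the energy of a convolution start from
    -- this form.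
    gram : (zs : List Y) (xs : List X) (a : X → R) (k : X → Y → R) →
           ∑ zs (λ z → ∑ xs (λ x → a x * k x z) * ∑ xs (λ x → a x * k x z))
           ≡ ∑ xs (λ x → ∑ xs (λ x′ → (a x * a x′) * ∑ zs (λ z → k x z * k x′ z)))
    gram zs xs a k = begin
      ∑ zs (λ z → ∑ xs (λ x → a x * k x z) * ∑ xs (λ x → a x * k x z))
        ≡⟨ ∑-cong zs (λ z → ∑-product xs xs _ _) ⟩
      ∑ zs (λ z → ∑ xs (λ x → ∑ xs (λ x′ → (a x * k x z) * (a x′ * k x′ z))))
        ≡⟨ ∑-cong zs (λ z → ∑-cong xs λ x → ∑-cong xs λ x′ → *-medial (a x) (k x z) (a x′) (k x′ z)) ⟩
      ∑ zs (λ z → ∑ xs (λ x → ∑ xs (λ x′ → (a x * a x′) * (k x z * k x′ z))))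
        ≡⟨ ∑-swap zs xs _ ⟩
      ∑ xs (λ x → ∑ zs (λ z → ∑ xs (λ x′ → (a x * a x′) * (k x z * k x′ z))))
        ≡⟨ ∑-cong xs (λ x → ∑-swap zs xs _) ⟩
      ∑ xs (λ x → ∑ xs (λ x′ → ∑ zs (λ z → (a x * a x′) * (k x z * k x′ z))))
        ≡⟨ ∑-cong xs (λ x → ∑-cong xs λ x′ → ∑-*ˡ zs (a x * a x′) _) ⟩
      ∑ xs (λ x → ∑ xs (λ x′ → (a x * a x′) * ∑ zs (λ z → k x z * k x′ z)))  ∎

  -- Every element of X occurs exactly once in the list, phrased as the only consequence about sums that matters.
  Enumerates : {X : Set} → List X → Set
  Enumerates {X} xs = ∀ x₀ (f : X → R) → (∀ x → x ≢ x₀ → f x ≡ 0#) → ∑ xs f ≡ f x₀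

  module _ {X : Set} where

    ∑-absent : (xs : List X) {x₀ : X} {f : X → R} → x₀ ∉ xs → (∀ x → x ≢ x₀ → f x ≡ 0#) → ∑ xs f ≡ 0#
    ∑-absent []       x₀∉ f≡0 = refl
    ∑-absent (x ∷ xs) x₀∉ f≡0 =
      trans (cong₂ _+_ (f≡0 x (λ x≡x₀ → x₀∉ (here (sym x≡x₀)))) (∑-absent xs (λ x₀∈ → x₀∉ (there x₀∈)) f≡0))
            (+-identityˡ 0#)

    ∑-present : {xs : List X} → Unique xs → ∀ {x₀} {f : X → R} → x₀ ∈ xs → (∀ x → x ≢ x₀ → f x ≡ 0#) → ∑ xs f ≡ f x₀
    ∑-present {x ∷ xs} (x∉ ∷ _) {f = f} (here refl) f≡0 =
      trans (cong (f x +_) (∑-absent xs (λ x∈ → All.lookup x∉ x∈ refl) f≡0)) (+-identityʳ (f x))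
    ∑-present {x ∷ xs} (x∉ ∷ uxs) {x₀} {f} (there x₀∈) f≡0 =
      trans (cong₂ _+_ (f≡0 x (All.lookup x∉ x₀∈)) (∑-present uxs x₀∈ f≡0)) (+-identityˡ (f x₀))

    unique-complete⇒enumerates : {xs : List X} → Unique xs → (∀ x → x ∈ xs) → Enumerates xs
    unique-complete⇒enumerates uxs ∈xs x₀ f f≡0 = ∑-present uxs (∈xs x₀) f≡0

    ∑-allVecs : (F : FiniteField) (xs : List X) (m : ℕ) (f : Vec X (suc m) → R) →
                ∑ (allVecs F xs (suc m)) f ≡ ∑ xs (λ x → ∑ (allVecs F xs m) (λ v → f (x ∷ v)))
    ∑-allVecs F xs m f = trans (∑-concatMap (λ x → map (x ∷_) (allVecs F xs m)) xs f)
                               (∑-cong xs (λ x → ∑-map (x ∷_) (allVecs F xs m) f))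

    allVecs-enumerates : (F : FiniteField) {xs : List X} → Enumerates xs → ∀ m → Enumerates (allVecs F xs m)
    allVecs-enumerates F enum zero    []        f f≡0 = +-identityʳ (f [])
    allVecs-enumerates F {xs} enum (suc m) (x₀ ∷ v₀) f f≡0 = begin
      ∑ (allVecs F xs (suc m)) f                            ≡⟨ ∑-allVecs F xs m f ⟩
      ∑ xs (λ x → ∑ (allVecs F xs m) (λ v → f (x ∷ v)))
        ≡⟨ enum x₀ _ (λ x x≢x₀ → ∑-zero (allVecs F xs m) (λ v → f≡0 (x ∷ v) λ { refl → x≢x₀ refl })) ⟩
      ∑ (allVecs F xs m) (λ v → f (x₀ ∷ v))
        ≡⟨ allVecs-enumerates F enum m v₀ _ (λ v v≢v₀ → f≡0 (x₀ ∷ v) λ { refl → v≢v₀ refl }) ⟩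
      f (x₀ ∷ v₀)                                           ∎

  -- Double counting along the graph of the bijection: `at y₀` is `f` cut down to the point `y₀`,
  -- each `f (φ x)` is written as a full sum of `at (φ x)`, and after the swap each `y` meets
  -- exactly one `x`. No permutation of lists has to be constructed.
  ∑-reindex : {X Y : Set} (xs : List X) (ys : List Y) → DecidableEquality Y →
              Enumerates xs → Enumerates ys →
              (φ : X → Y) (ψ : Y → X) → (∀ y → φ (ψ y) ≡ y) → (∀ x → ψ (φ x) ≡ x) →
              (f : Y → R) → ∑ xs (λ x → f (φ x)) ≡ ∑ ys f
  ∑-reindex {X} {Y} xs ys _≟_ enumX enumY φ ψ φψ ψφ f = begin
    ∑ xs (λ x → f (φ x))
      ≡⟨ ∑-cong xs (λ x → trans (sym (at-refl (φ x))) (sym (enumY (φ x) (at (φ x)) (at-≢ (φ x))))) ⟩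
    ∑ xs (λ x → ∑ ys (at (φ x)))
      ≡⟨ ∑-swap xs ys (λ x → at (φ x)) ⟩
    ∑ ys (λ y → ∑ xs (λ x → at (φ x) y))
      ≡⟨ ∑-cong ys (λ y → trans (enumX (ψ y) (λ x → at (φ x) y)
           (λ x x≢ → at-≢ (φ x) y (λ y≡ → x≢ (trans (sym (ψφ x)) (cong ψ (sym y≡))))))
           (trans (cong (λ z → at z y) (φψ y)) (at-refl y))) ⟩
    ∑ ys f  ∎
    where
    at : Y → Y → R
    at y₀ y with y ≟ y₀
    ... | yes _ = f y
    ... | no  _ = 0#

    at-refl : ∀ y → at y y ≡ f y
    at-refl y with y ≟ y
    ... | yes _   = refl
    ... | no  y≢y = contradiction refl y≢y

    at-≢ : ∀ y₀ y → y ≢ y₀ → at y₀ y ≡ 0#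
    at-≢ y₀ y y≢ with y ≟ y₀
    ... | yes y≡ = contradiction y≡ y≢
    ... | no  _  = refl

-- Indicators, inequalities and Cauchy-Schwarz over the integers.

module IntegerSums where
  open import Data.Integer using (ℤ; +_; -[1+_]; _+_; _*_; _-_; _≤_; 0ℤ; 1ℤ; +≤+)

  open Summation ℤ.+-*-isCommutativeRing public

  ι : Bool → ℤ
  ι true  = 1ℤ
  ι false = 0ℤ

  ι-idem : ∀ b → ι b * ι b ≡ ι b
  ι-idem true  = refl
  ι-idem false = refl

  0≤ι : ∀ b → 0ℤ ≤ ι b
  0≤ι true  = +≤+ z≤n
  0≤ι false = +≤+ z≤n

  ι≤1 : ∀ b → ι b ≤ 1ℤ
  ι≤1 true  = ℤ.≤-refl
  ι≤1 false = +≤+ z≤n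

  ι*ι≤ι : ∀ a b → ι a * ι b ≤ ι b
  ι*ι≤ι true  true  = ℤ.≤-refl
  ι*ι≤ι true  false = ℤ.≤-refl
  ι*ι≤ι false true  = +≤+ z≤n
  ι*ι≤ι false false = ℤ.≤-refl

  ι*-cong : ∀ b {i j} → (T b → i ≡ j) → ι b * i ≡ ι b * j
  ι*-cong true          i≡j = cong (1ℤ *_) (i≡j _)
  ι*-cong false {i} {j} i≡j = trans (ℤ.*-zeroˡ i) (sym (ℤ.*-zeroˡ j))

  ι-yes : {P : Set} (P? : Dec P) → P → ι (does P?) ≡ 1ℤ
  ι-yes P? p = cong ι (dec-true P? p)

  ι-no : {P : Set} (P? : Dec P) → ¬ P → ι (does P?) ≡ 0ℤ
  ι-no P? ¬p = cong ι (dec-false P? ¬p)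

  ι-cong : {P R : Set} (P? : Dec P) (R? : Dec R) → (P → R) → (R → P) → ι (does P?) ≡ ι (does R?)
  ι-cong (yes p) R? f g = sym (ι-yes R? (f p))
  ι-cong (no ¬p) R? f g = sym (ι-no R? (λ r → ¬p (g r)))

  square-nonneg : ∀ i → 0ℤ ≤ i * i
  square-nonneg (+ zero)  = ℤ.≤-refl
  square-nonneg (+ suc n) = +≤+ z≤n
  square-nonneg -[1+ n ]  = +≤+ z≤n

  *-monoˡ-≤-0≤ : ∀ {k i j} → 0ℤ ≤ k → i ≤ j → k * i ≤ k * j
  *-monoˡ-≤-0≤ {+ k} _ i≤j = ℤ.*-monoˡ-≤-nonNeg (+ k) i≤j

  0≤* : ∀ {i j} → 0ℤ ≤ i → 0ℤ ≤ j → 0ℤ ≤ i * j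
  0≤* {i} {j} 0≤i 0≤j = subst (_≤ i * j) (ℤ.*-zeroʳ i) (*-monoˡ-≤-0≤ 0≤i 0≤j)

  square-swap : ∀ a b → a * a + b * b ≡ (a - b) * (a - b) + (a * b + a * b)
  square-swap = solve-∀

  2ab≤a²+b² : ∀ a b → a * b + a * b ≤ a * a + b * b
  2ab≤a²+b² a b = subst₂ _≤_ (ℤ.+-identityˡ _) (sym (square-swap a b)) (ℤ.+-monoˡ-≤ (a * b + a * b) (square-nonneg (a - b)))

  double-cancel-≤ : ∀ {i j} → i + i ≤ j + j → i ≤ j
  double-cancel-≤ {i} {j} 2i≤2j = ℤ.*-cancelˡ-≤-pos i j (+ 2) (subst₂ _≤_ (double i) (double j) 2i≤2j)
    where
    double : ∀ i → i + i ≡ + 2 * i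
    double = solve-∀

  module _ {X : Set} where

    ∑-mono-≤ : (xs : List X) {f g : X → ℤ} → (∀ x → f x ≤ g x) → ∑ xs f ≤ ∑ xs g
    ∑-mono-≤ []       f≤g = ℤ.≤-refl
    ∑-mono-≤ (x ∷ xs) f≤g = ℤ.+-mono-≤ (f≤g x) (∑-mono-≤ xs f≤g)

    ∑-nonneg : (xs : List X) {f : X → ℤ} → (∀ x → 0ℤ ≤ f x) → 0ℤ ≤ ∑ xs f
    ∑-nonneg xs {f} 0≤f = subst (_≤ ∑ xs f) (∑-zero xs (λ _ → refl)) (∑-mono-≤ xs 0≤f)

    ∑-const : (xs : List X) (k : ℤ) → ∑ xs (λ _ → k) ≡ + length xs * k
    ∑-const []       k = refl
    ∑-const (x ∷ xs) k = trans (cong (_+_ k) (∑-const xs k)) (sym (ℤ.suc-* (+ length xs) k))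

    length-filterᵇ : (S : X → Bool) (xs : List X) → + length (filterᵇ S xs) ≡ ∑ xs (λ x → ι (S x))
    length-filterᵇ S []       = refl
    length-filterᵇ S (x ∷ xs) with S x
    ... | true  = cong (_+_ 1ℤ) (length-filterᵇ S xs)
    ... | false = trans (length-filterᵇ S xs) (sym (ℤ.+-identityˡ _))

    -- Twice the left side is a double sum of 2ab with a = `w x * f y` and b = `w y * f x`. Bounding
    -- it termwise by a² + b² gives two copies of the right side, equal by symmetry in x and y.
    -- Working with doubled quantities avoids division.
    cauchy-schwarz : (xs : List X) (w f : X → ℤ) →
      ∑ xs (λ x → w x * f x) * ∑ xs (λ x → w x * f x) ≤ ∑ xs (λ x → w x * w x) * ∑ xs (λ x → f x * f x)
    cauchy-schwarz xs w f = double-cancel-≤ (begin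
      wf * wf + wf * wf
        ≡⟨ cong₂ _+_ (trans (∑-product xs xs _ _) (∑-cong xs λ x → ∑-cong xs λ y → mixed (w x) (f x) (w y) (f y)))
                     (trans (∑-product xs xs _ _) (∑-cong xs λ x → ∑-cong xs λ y → mixed (w x) (f x) (w y) (f y))) ⟩
      ∑² (λ x y → (w x * f y) * (w y * f x)) + ∑² (λ x y → (w x * f y) * (w y * f x))
        ≡⟨ ∑²-+ _ _ ⟨
      ∑² (λ x y → (w x * f y) * (w y * f x) + (w x * f y) * (w y * f x))
        ≤⟨ ∑-mono-≤ xs (λ x → ∑-mono-≤ xs λ y → 2ab≤a²+b² (w x * f y) (w y * f x)) ⟩
      ∑² (λ x y → (w x * f y) * (w x * f y) + (w y * f x) * (w y * f x))
        ≡⟨ ∑²-+ _ _ ⟩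
      ∑² (λ x y → (w x * f y) * (w x * f y)) + ∑² (λ x y → (w y * f x) * (w y * f x))
        ≡⟨ cong (_+_ (∑² (λ x y → (w x * f y) * (w x * f y)))) (∑-swap xs xs _) ⟩
      ∑² (λ x y → (w x * f y) * (w x * f y)) + ∑² (λ x y → (w x * f y) * (w x * f y))
        ≡⟨ cong₂ _+_ ww*ff ww*ff ⟩
      ww * ff + ww * ff ∎)
      where
      open ℤ.≤-Reasoning
      wf ww ff : ℤ
      wf = ∑ xs (λ x → w x * f x)
      ww = ∑ xs (λ x → w x * w x)
      ff = ∑ xs (λ x → f x * f x)

      ∑² : (X → X → ℤ) → ℤ
      ∑² k = ∑ xs (λ x → ∑ xs (k x))

      ∑²-+ : ∀ k l → ∑² (λ x y → k x y + l x y) ≡ ∑² k + ∑² l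
      ∑²-+ k l = trans (∑-cong xs (λ x → ∑-+ xs (k x) (l x))) (∑-+ xs _ _)

      mixed : ∀ a b c d → (a * b) * (c * d) ≡ (a * d) * (c * b)
      mixed = solve-∀

      squares : ∀ a b → (a * b) * (a * b) ≡ (a * a) * (b * b)
      squares = solve-∀

      ww*ff : ∑² (λ x y → (w x * f y) * (w x * f y)) ≡ ww * ff
      ww*ff = trans (∑-cong xs (λ x → ∑-cong xs λ y → squares (w x) (f y))) (sym (∑-product xs xs _ _))

  energy : {X : Set} → List X → (X → ℤ) → ℤ
  energy xs f = ∑ xs (λ x → f x * f x)

  energy-nonneg : {X : Set} (xs : List X) (f : X → ℤ) → 0ℤ ≤ energy xs f
  energy-nonneg xs f = ∑-nonneg xs (λ x → square-nonneg (f x))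

-- The matrix space: Frobenius pairing, transposed action, averaging over translates.

vec-ext : {A : Set} {m : ℕ} {u v : Vec A m} → (∀ i → lookup u i ≡ lookup v i) → u ≡ v
vec-ext {u = u} {v} u≡v = trans (sym (tabulate∘lookup u)) (trans (tabulate-cong u≡v) (tabulate∘lookup v))

module MatrixSpace (F : FiniteField) (n : ℕ) where
  open IntegerSums
  open import Data.Integer using (ℤ; +_; _*_; _≤_; 1ℤ)
  open FiniteField F public using (Carrier; 0#; 1#; 0≢1; inverse; _≟_; elements; complete; unique; size)
    renaming (_+_ to infixl 6 _⊕_; _*_ to infixl 7 _⊗_; -_ to infix 8 ⊖_; isCommutativeRing to F-isCommutativeRing)
  open Summation F-isCommutativeRing public using ()
    renaming (∑ to ∑ꟳ; ∑-cong to ∑ꟳ-cong; ∑-+ to ∑ꟳ-+; ∑-*ˡ to ∑ꟳ-*ˡ; ∑-*ʳ to ∑ꟳ-*ʳ; ∑-swap to ∑ꟳ-swap; ∑-zero to ∑ꟳ-zero;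
              Enumerates to Enumeratesꟳ; unique-complete⇒enumerates to unique-complete⇒enumeratesꟳ)

  commutativeRing : CommutativeRing _ _
  commutativeRing = record { isCommutativeRing = F-isCommutativeRing }

  open CommutativeRing commutativeRing public using (+-group; distribʳ; distribˡ; zeroʳ; zeroˡ)
    renaming (+-identityˡ to ⊕-identityˡ; -‿inverseʳ to ⊖-inverseʳ; +-comm to ⊕-comm; +-assoc to ⊕-assoc; *-comm to ⊗-comm; *-assoc to ⊗-assoc; *-identityˡ to ⊗-identityˡ; *-identityʳ to ⊗-identityʳ)
  open import Algebra.Properties.Group +-group public using ()
    renaming (//-rightDividesˡ to ⊖-⊕; //-rightDividesʳ to ⊕-⊖)
  open ≡-Reasoning

  _⊝_ : Carrier → Carrier → Carrier
  x ⊝ y = x ⊕ ⊖ y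
  infixl 6 _⊝_

  M : Set
  M = Matrix F n

  _+ᴹ_ _*ᴹ_ : M → M → M
  _+ᴹ_ = Defs._+ᴹ_ F
  _*ᴹ_ = Defs._*ᴹ_ F

  _≟ᴹ_ : (X Y : M) → Dec (X ≡ Y)
  _≟ᴹ_ = Defs._≟ᴹ_ F

  matrix : (Fin n → Fin n → Carrier) → M
  matrix f = tabulate λ i → tabulate (f i)

  entry : M → Fin n → Fin n → Carrier
  entry X i j = lookup (lookup X i) j

  entry-matrix : ∀ f i j → entry (matrix f) i j ≡ f i j
  entry-matrix f i j = trans (cong (λ r → lookup r j) (lookup∘tabulate _ i)) (lookup∘tabulate (f i) j)

  matrix-ext : {X Y : M} → (∀ i j → entry X i j ≡ entry Y i j) → X ≡ Y
  matrix-ext X≡Y = vec-ext λ i → vec-ext (X≡Y i)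

  -- Equality of entries is decidable and the index set finite, so a differing entry can be found by
  -- search. The averaging arguments translate along this entry or its row.
  ≢⇒entry-≢ : {X Y : M} → X ≢ Y → ∃ λ i → ∃ λ j → entry X i j ≢ entry Y i j
  ≢⇒entry-≢ {X} {Y} X≢Y with Fin.¬∀⟶∃¬ n _ (λ i → Fin.all? (λ j → entry X i j ≟ entry Y i j)) (λ all → X≢Y (matrix-ext all))
  ... | i , ¬row with Fin.¬∀⟶∃¬ n _ (λ j → entry X i j ≟ entry Y i j) ¬row
  ...   | j , X≢Y-ij = i , j , X≢Y-ij

  0ᴹ : M
  0ᴹ = matrix λ _ _ → 0#

  _-ᴹ_ : M → M → M
  X -ᴹ Y = matrix λ i j → entry X i j ⊝ entry Y i j

  +ᴹ-entry : ∀ X Y i j → entry (X +ᴹ Y) i j ≡ entry X i j ⊕ entry Y i j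
  +ᴹ-entry X Y = entry-matrix _

  -ᴹ-+ᴹ : ∀ X Y → (X -ᴹ Y) +ᴹ Y ≡ X
  -ᴹ-+ᴹ X Y = matrix-ext λ i j → trans (+ᴹ-entry (X -ᴹ Y) Y i j) (trans (cong (_⊕ entry Y i j) (entry-matrix _ i j)) (⊖-⊕ _ _))

  +ᴹ--ᴹ : ∀ X Y → (X +ᴹ Y) -ᴹ Y ≡ X
  +ᴹ--ᴹ X Y = matrix-ext λ i j → trans (entry-matrix _ i j) (trans (cong (_⊝ entry Y i j) (+ᴹ-entry X Y i j)) (⊕-⊖ _ _))

  Is : List (Fin n)
  Is = allFin n

  Is-enumerates : Enumeratesꟳ Is
  Is-enumerates = unique-complete⇒enumeratesꟳ (allFin⁺ n) ∈-allFin

  ⟪_,_⟫ : M → M → Carrier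
  ⟪ X , Y ⟫ = ∑ꟳ Is λ i → ∑ꟳ Is λ j → entry X i j ⊗ entry Y i j

  ⟪⟫-comm : ∀ X Y → ⟪ X , Y ⟫ ≡ ⟪ Y , X ⟫
  ⟪⟫-comm X Y = ∑ꟳ-cong Is λ i → ∑ꟳ-cong Is λ j → ⊗-comm _ _

  ⟪⟫-+ʳ : ∀ X Y Z → ⟪ X , Y +ᴹ Z ⟫ ≡ ⟪ X , Y ⟫ ⊕ ⟪ X , Z ⟫
  ⟪⟫-+ʳ X Y Z = begin
    ∑ꟳ Is (λ i → ∑ꟳ Is λ j → entry X i j ⊗ entry (Y +ᴹ Z) i j)
      ≡⟨ ∑ꟳ-cong Is (λ i → ∑ꟳ-cong Is λ j → trans (cong (entry X i j ⊗_) (+ᴹ-entry Y Z i j)) (distribˡ _ _ _)) ⟩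
    ∑ꟳ Is (λ i → ∑ꟳ Is λ j → entry X i j ⊗ entry Y i j ⊕ entry X i j ⊗ entry Z i j)
      ≡⟨ ∑ꟳ-cong Is (λ i → ∑ꟳ-+ Is _ _) ⟩
    ∑ꟳ Is (λ i → ∑ꟳ Is (λ j → entry X i j ⊗ entry Y i j) ⊕ ∑ꟳ Is (λ j → entry X i j ⊗ entry Z i j))
      ≡⟨ ∑ꟳ-+ Is _ _ ⟩
    ⟪ X , Y ⟫ ⊕ ⟪ X , Z ⟫  ∎

  ⟪⟫--ˡ : ∀ X Y Z → ⟪ X -ᴹ Y , Z ⟫ ≡ ⟪ X , Z ⟫ ⊝ ⟪ Y , Z ⟫
  ⟪⟫--ˡ X Y Z = begin
    ⟪ X -ᴹ Y , Z ⟫                             ≡⟨ ⊕-⊖ _ _ ⟨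
    ⟪ X -ᴹ Y , Z ⟫ ⊕ ⟪ Y , Z ⟫ ⊝ ⟪ Y , Z ⟫     ≡⟨ cong (_⊝ ⟪ Y , Z ⟫) (cong₂ _⊕_ (⟪⟫-comm (X -ᴹ Y) Z) (⟪⟫-comm Y Z)) ⟩
    ⟪ Z , X -ᴹ Y ⟫ ⊕ ⟪ Z , Y ⟫ ⊝ ⟪ Y , Z ⟫     ≡⟨ cong (_⊝ ⟪ Y , Z ⟫) (⟪⟫-+ʳ Z (X -ᴹ Y) Y) ⟨
    ⟪ Z , (X -ᴹ Y) +ᴹ Y ⟫ ⊝ ⟪ Y , Z ⟫          ≡⟨ cong (_⊝ ⟪ Y , Z ⟫) (trans (cong ⟪ Z ,_⟫ (-ᴹ-+ᴹ X Y)) (⟪⟫-comm Z X)) ⟩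
    ⟪ X , Z ⟫ ⊝ ⟪ Y , Z ⟫                      ∎

  ⟪0,⟫ : ∀ X → ⟪ 0ᴹ , X ⟫ ≡ 0#
  ⟪0,⟫ X = ∑ꟳ-zero Is λ i → ∑ꟳ-zero Is λ j → trans (cong (_⊗ entry X i j) (entry-matrix _ i j)) (zeroˡ _)

  single : Fin n → Fin n → Carrier → M
  single k l x = matrix λ i j → if does (i Fin.≟ k) then (if does (j Fin.≟ l) then x else 0#) else 0#

  single-entry : ∀ k l x → entry (single k l x) k l ≡ x
  single-entry k l x rewrite entry-matrix (λ i j → if does (i Fin.≟ k) then (if does (j Fin.≟ l) then x else 0#) else 0#) k l
    with k Fin.≟ k | l Fin.≟ l
  ... | yes _  | yes _  = refl
  ... | no k≢k | _      = contradiction refl k≢k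
  ... | yes _  | no l≢l = contradiction refl l≢l

  single-entry-row : ∀ k l x i j → i ≢ k → entry (single k l x) i j ≡ 0#
  single-entry-row k l x i j i≢k rewrite entry-matrix (λ i j → if does (i Fin.≟ k) then (if does (j Fin.≟ l) then x else 0#) else 0#) i j
    with i Fin.≟ k
  ... | yes i≡k = contradiction i≡k i≢k
  ... | no  _   = refl

  single-entry-col : ∀ k l x i j → j ≢ l → entry (single k l x) i j ≡ 0#
  single-entry-col k l x i j j≢l rewrite entry-matrix (λ i j → if does (i Fin.≟ k) then (if does (j Fin.≟ l) then x else 0#) else 0#) i j
    with i Fin.≟ k | j Fin.≟ l
  ... | _     | yes j≡l = contradiction j≡l j≢l
  ... | yes _ | no  _   = refl
  ... | no  _ | no  _   = refl

  ⟪,single⟫ : ∀ X k l x → ⟪ X , single k l x ⟫ ≡ entry X k l ⊗ x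
  ⟪,single⟫ X k l x = begin
    ⟪ X , single k l x ⟫
      ≡⟨ Is-enumerates k _ (λ i i≢k → ∑ꟳ-zero Is λ j → trans (cong (_ ⊗_) (single-entry-row k l x i j i≢k)) (zeroʳ _)) ⟩
    ∑ꟳ Is (λ j → entry X k j ⊗ entry (single k l x) k j)
      ≡⟨ Is-enumerates l _ (λ j j≢l → trans (cong (_ ⊗_) (single-entry-col k l x k j j≢l)) (zeroʳ _)) ⟩
    entry X k l ⊗ entry (single k l x) k l
      ≡⟨ cong (entry X k l ⊗_) (single-entry k l x) ⟩
    entry X k l ⊗ x  ∎

  -- adj t b = bᵀ t: the map λ t → adj t b is adjoint to left multiplication by b under the Frobenius pairing.
  adj : M → M → M
  adj t b = matrix λ k j → ∑ꟳ Is λ i → entry b i k ⊗ entry t i j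

  ⟪,*⟫ : ∀ t b c → ⟪ t , b *ᴹ c ⟫ ≡ ⟪ adj t b , c ⟫
  ⟪,*⟫ t b c = begin
    ∑ꟳ Is (λ i → ∑ꟳ Is λ j → entry t i j ⊗ entry (b *ᴹ c) i j)
      ≡⟨ ∑ꟳ-cong Is (λ i → ∑ꟳ-cong Is λ j → trans (cong (entry t i j ⊗_) (entry-matrix _ i j)) (sym (∑ꟳ-*ˡ Is _ _))) ⟩
    ∑ꟳ Is (λ i → ∑ꟳ Is λ j → ∑ꟳ Is λ k → entry t i j ⊗ (entry b i k ⊗ entry c k j))
      ≡⟨ ∑ꟳ-cong Is (λ i → ∑ꟳ-swap Is Is _) ⟩
    ∑ꟳ Is (λ i → ∑ꟳ Is λ k → ∑ꟳ Is λ j → entry t i j ⊗ (entry b i k ⊗ entry c k j))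
      ≡⟨ ∑ꟳ-swap Is Is _ ⟩
    ∑ꟳ Is (λ k → ∑ꟳ Is λ i → ∑ꟳ Is λ j → entry t i j ⊗ (entry b i k ⊗ entry c k j))
      ≡⟨ ∑ꟳ-cong Is (λ k → ∑ꟳ-swap Is Is _) ⟩
    ∑ꟳ Is (λ k → ∑ꟳ Is λ j → ∑ꟳ Is λ i → entry t i j ⊗ (entry b i k ⊗ entry c k j))
      ≡⟨ ∑ꟳ-cong Is (λ k → ∑ꟳ-cong Is λ j → ∑ꟳ-cong Is λ i →
           trans (sym (⊗-assoc _ _ _)) (cong (_⊗ entry c k j) (⊗-comm _ _))) ⟩
    ∑ꟳ Is (λ k → ∑ꟳ Is λ j → ∑ꟳ Is λ i → (entry b i k ⊗ entry t i j) ⊗ entry c k j)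
      ≡⟨ ∑ꟳ-cong Is (λ k → ∑ꟳ-cong Is λ j → trans (∑ꟳ-*ʳ Is _ _) (cong (_⊗ entry c k j) (sym (entry-matrix _ k j)))) ⟩
    ⟪ adj t b , c ⟫  ∎

  adj-+ : ∀ t b b′ k j → entry (adj t (b +ᴹ b′)) k j ≡ entry (adj t b) k j ⊕ entry (adj t b′) k j
  adj-+ t b b′ k j = begin
    entry (adj t (b +ᴹ b′)) k j
      ≡⟨ entry-matrix _ k j ⟩
    ∑ꟳ Is (λ i → entry (b +ᴹ b′) i k ⊗ entry t i j)
      ≡⟨ ∑ꟳ-cong Is (λ i → trans (cong (_⊗ _) (+ᴹ-entry b b′ i k)) (distribʳ _ _ _)) ⟩
    ∑ꟳ Is (λ i → entry b i k ⊗ entry t i j ⊕ entry b′ i k ⊗ entry t i j)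
      ≡⟨ ∑ꟳ-+ Is _ _ ⟩
    ∑ꟳ Is (λ i → entry b i k ⊗ entry t i j) ⊕ ∑ꟳ Is (λ i → entry b′ i k ⊗ entry t i j)
      ≡⟨ cong₂ _⊕_ (sym (entry-matrix _ k j)) (sym (entry-matrix _ k j)) ⟩
    entry (adj t b) k j ⊕ entry (adj t b′) k j  ∎

  row : Fin n → Vec Carrier n → M
  row l u = matrix λ i j → if does (i Fin.≟ l) then lookup u j else 0#

  row-entry : ∀ l u j → entry (row l u) l j ≡ lookup u j
  row-entry l u j rewrite entry-matrix (λ i j → if does (i Fin.≟ l) then lookup u j else 0#) l j with l Fin.≟ l
  ... | yes _   = refl
  ... | no  l≢l = contradiction refl l≢l

  row-entry-≢ : ∀ l u i j → i ≢ l → entry (row l u) i j ≡ 0#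
  row-entry-≢ l u i j i≢l rewrite entry-matrix (λ i j → if does (i Fin.≟ l) then lookup u j else 0#) i j with i Fin.≟ l
  ... | yes i≡l = contradiction i≡l i≢l
  ... | no  _   = refl

  -- The matrix (`row l u`)ᵀ t has rank at most one: it is the outer product of `u` with row `l` of
  -- `t`. If that row has a nonzero entry, one column therefore determines `u`.
  adj-row : ∀ t l u k j → entry (adj t (row l u)) k j ≡ lookup u k ⊗ entry t l j
  adj-row t l u k j = begin
    entry (adj t (row l u)) k j                       ≡⟨ entry-matrix _ k j ⟩
    ∑ꟳ Is (λ i → entry (row l u) i k ⊗ entry t i j)
      ≡⟨ Is-enumerates l _ (λ i i≢l → trans (cong (_⊗ _) (row-entry-≢ l u i k i≢l)) (zeroˡ _)) ⟩
    entry (row l u) l k ⊗ entry t l j                 ≡⟨ cong (_⊗ _) (row-entry l u k) ⟩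
    lookup u k ⊗ entry t l j                          ∎

  𝔽 : List Carrier
  𝔽 = elements

  𝕍 : List (Vec Carrier n)
  𝕍 = allVecs F elements n

  𝕄 : List M
  𝕄 = allMatrices F n

  𝔽-enumerates : Enumerates 𝔽
  𝔽-enumerates = unique-complete⇒enumerates unique complete

  𝕍-enumerates : Enumerates 𝕍
  𝕍-enumerates = allVecs-enumerates F 𝔽-enumerates n

  𝕄-enumerates : Enumerates 𝕄
  𝕄-enumerates = allVecs-enumerates F 𝕍-enumerates n

  -- Kept as list lengths, the form in which `∑-const` produces them. They become powers of the
  -- field size only when the final bound is moved to natural numbers.
  q qⁿ Q : ℤ
  q  = + length 𝔽
  qⁿ = + length 𝕍
  Q  = + length 𝕄

  ∑𝕄-shift : ∀ X (f : M → ℤ) → ∑ 𝕄 (λ Y → f (Y +ᴹ X)) ≡ ∑ 𝕄 f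
  ∑𝕄-shift X = ∑-reindex 𝕄 𝕄 _≟ᴹ_ 𝕄-enumerates 𝕄-enumerates (_+ᴹ X) (_-ᴹ X) (λ Y → -ᴹ-+ᴹ Y X) (λ Y → +ᴹ--ᴹ Y X)

  ∑𝕄-unshift : ∀ X (f : M → ℤ) → ∑ 𝕄 (λ Y → f (Y -ᴹ X)) ≡ ∑ 𝕄 f
  ∑𝕄-unshift X = ∑-reindex 𝕄 𝕄 _≟ᴹ_ 𝕄-enumerates 𝕄-enumerates (_-ᴹ X) (_+ᴹ X) (λ Y → +ᴹ--ᴹ Y X) (λ Y → -ᴹ-+ᴹ Y X)

  ∑𝔽-shift : ∀ x (f : Carrier → ℤ) → ∑ 𝔽 (λ v → f (v ⊕ x)) ≡ ∑ 𝔽 f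
  ∑𝔽-shift x = ∑-reindex 𝔽 𝔽 _≟_ 𝔽-enumerates 𝔽-enumerates (_⊕ x) (_⊝ x) (λ y → ⊖-⊕ x y) (λ y → ⊕-⊖ x y)

  ∑𝔽-affine : ∀ u x → u ≢ 0# → (f : Carrier → ℤ) → ∑ 𝔽 (λ v → f (x ⊕ u ⊗ v)) ≡ ∑ 𝔽 f
  ∑𝔽-affine u x u≢0 f with inverse u u≢0
  ... | u⁻¹ , uu⁻¹≡1 = ∑-reindex 𝔽 𝔽 _≟_ 𝔽-enumerates 𝔽-enumerates (λ v → x ⊕ u ⊗ v) (λ v → u⁻¹ ⊗ (v ⊝ x))
    (λ v → begin
      x ⊕ u ⊗ (u⁻¹ ⊗ (v ⊝ x))  ≡⟨ cong (x ⊕_) (⊗-assoc u u⁻¹ _) ⟨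
      x ⊕ u ⊗ u⁻¹ ⊗ (v ⊝ x)    ≡⟨ cong (λ z → x ⊕ z ⊗ (v ⊝ x)) uu⁻¹≡1 ⟩
      x ⊕ _ ⊗ (v ⊝ x)          ≡⟨ cong (x ⊕_) (⊗-identityˡ _) ⟩
      x ⊕ (v ⊝ x)              ≡⟨ ⊕-comm x _ ⟩
      v ⊝ x ⊕ x                ≡⟨ ⊖-⊕ x v ⟩
      v                        ∎)
    (λ v → begin
      u⁻¹ ⊗ (x ⊕ u ⊗ v ⊝ x)    ≡⟨ cong (λ z → u⁻¹ ⊗ (z ⊝ x)) (⊕-comm x _) ⟩
      u⁻¹ ⊗ (u ⊗ v ⊕ x ⊝ x)    ≡⟨ cong (u⁻¹ ⊗_) (⊕-⊖ x _) ⟩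
      u⁻¹ ⊗ (u ⊗ v)            ≡⟨ ⊗-assoc u⁻¹ u v ⟨
      u⁻¹ ⊗ u ⊗ v              ≡⟨ cong (_⊗ v) (trans (⊗-comm u⁻¹ u) uu⁻¹≡1) ⟩
      _ ⊗ v                    ≡⟨ ⊗-identityˡ v ⟩
      v                        ∎) f

  -- This lemma and adj-fibre average over translates of the summation variable along one entry or one row.
  equidistribution : ∀ {X Y} → X ≢ Y → (h : Carrier → ℤ) →
                     q * ∑ 𝕄 (λ Z → h (⟪ X , Z ⟫ ⊝ ⟪ Y , Z ⟫)) ≡ Q * ∑ 𝔽 h
  equidistribution {X} {Y} X≢Y h with ≢⇒entry-≢ X≢Y
  ... | i , j , X≢Y-ij = begin
    q * ∑ 𝕄 (λ Z → h (⟪ X , Z ⟫ ⊝ ⟪ Y , Z ⟫))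
      ≡⟨ ∑-const 𝔽 _ ⟨
    ∑ 𝔽 (λ x → ∑ 𝕄 (λ Z → h (⟪ X , Z ⟫ ⊝ ⟪ Y , Z ⟫)))
      ≡⟨ ∑-cong 𝔽 (λ x → ∑-cong 𝕄 λ Z → cong h (sym (⟪⟫--ˡ X Y Z))) ⟩
    ∑ 𝔽 (λ x → ∑ 𝕄 (λ Z → h ⟪ D , Z ⟫))
      ≡⟨ ∑-cong 𝔽 (λ x → ∑𝕄-shift (single i j x) (λ Z → h ⟪ D , Z ⟫)) ⟨
    ∑ 𝔽 (λ x → ∑ 𝕄 (λ Z → h ⟪ D , Z +ᴹ single i j x ⟫))
      ≡⟨ ∑-cong 𝔽 (λ x → ∑-cong 𝕄 λ Z → cong h (trans (⟪⟫-+ʳ D Z (single i j x)) (cong (⟪ D , Z ⟫ ⊕_) (⟪,single⟫ D i j x)))) ⟩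
    ∑ 𝔽 (λ x → ∑ 𝕄 (λ Z → h (⟪ D , Z ⟫ ⊕ entry D i j ⊗ x)))
      ≡⟨ ∑-swap 𝔽 𝕄 _ ⟩
    ∑ 𝕄 (λ Z → ∑ 𝔽 (λ x → h (⟪ D , Z ⟫ ⊕ entry D i j ⊗ x)))
      ≡⟨ ∑-cong 𝕄 (λ Z → ∑𝔽-affine (entry D i j) ⟪ D , Z ⟫ D≢0 h) ⟩
    ∑ 𝕄 (λ Z → ∑ 𝔽 h)
      ≡⟨ ∑-const 𝕄 _ ⟩
    Q * ∑ 𝔽 h  ∎
    where
    D : M
    D = X -ᴹ Y
    D≢0 : entry D i j ≢ 0#
    D≢0 D≡0 = X≢Y-ij (begin
      entry X i j                              ≡⟨ ⊖-⊕ _ _ ⟨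
      entry X i j ⊝ entry Y i j ⊕ entry Y i j  ≡⟨ cong (_⊕ entry Y i j) (trans (sym (entry-matrix _ i j)) D≡0) ⟩
      0# ⊕ entry Y i j                         ≡⟨ ⊕-identityˡ _ ⟩
      entry Y i j                              ∎)

  adj-fibre : ∀ {t} → t ≢ 0ᴹ → ∀ Y → qⁿ * ∑ 𝕄 (λ b → ι (does (Y ≟ᴹ adj t b))) ≤ Q
  adj-fibre {t} t≢0 Y with ≢⇒entry-≢ t≢0
  ... | l , j , t≢0-lj with inverse (entry t l j) (λ t≡0 → t≢0-lj (trans t≡0 (sym (entry-matrix _ l j))))
  ...   | τ , tτ≡1 = subst (_≤ Q) (sym averaged) bound
    where
    fibre : M → ℤ
    fibre b = ι (does (Y ≟ᴹ adj t b))

    averaged : qⁿ * ∑ 𝕄 fibre ≡ ∑ 𝕄 (λ b → ∑ 𝕍 (λ u → fibre (b +ᴹ row l u)))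
    averaged = begin
      qⁿ * ∑ 𝕄 fibre                                    ≡⟨ ∑-const 𝕍 _ ⟨
      ∑ 𝕍 (λ u → ∑ 𝕄 fibre)                             ≡⟨ ∑-cong 𝕍 (λ u → ∑𝕄-shift (row l u) fibre) ⟨
      ∑ 𝕍 (λ u → ∑ 𝕄 (λ b → fibre (b +ᴹ row l u)))      ≡⟨ ∑-swap 𝕍 𝕄 _ ⟩
      ∑ 𝕄 (λ b → ∑ 𝕍 (λ u → fibre (b +ᴹ row l u)))      ∎

    -- Adding `row l u` to `b` adds `u k` times `entry t l j` to entry (k, j) of bᵀt. Since `τ`
    -- inverts `entry t l j`, column `j` of the target `Y` leaves only one candidate for `u`.
    solution : M → Vec Carrier n
    solution b = tabulate λ k → (entry Y k j ⊝ entry (adj t b) k j) ⊗ τ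

    solution-unique : ∀ b u → Y ≡ adj t (b +ᴹ row l u) → u ≡ solution b
    solution-unique b u refl = vec-ext λ k → sym (begin
      lookup (solution b) k
        ≡⟨ lookup∘tabulate _ k ⟩
      (entry (adj t (b +ᴹ row l u)) k j ⊝ entry (adj t b) k j) ⊗ τ
        ≡⟨ cong (λ z → (z ⊝ entry (adj t b) k j) ⊗ τ) (trans (adj-+ t b (row l u) k j) (⊕-comm _ _)) ⟩
      (entry (adj t (row l u)) k j ⊕ entry (adj t b) k j ⊝ entry (adj t b) k j) ⊗ τ
        ≡⟨ cong (_⊗ τ) (⊕-⊖ _ _) ⟩
      entry (adj t (row l u)) k j ⊗ τ
        ≡⟨ cong (_⊗ τ) (adj-row t l u k j) ⟩
      lookup u k ⊗ entry t l j ⊗ τ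
        ≡⟨ trans (⊗-assoc _ _ _) (cong (lookup u k ⊗_) tτ≡1) ⟩
      lookup u k ⊗ _
        ≡⟨ ⊗-identityʳ _ ⟩
      lookup u k  ∎)

    bound : ∑ 𝕄 (λ b → ∑ 𝕍 (λ u → fibre (b +ᴹ row l u))) ≤ Q
    bound = ℤ.≤-trans
      -- The inner sum collapses to the value at its only candidate `u`, an indicator that may still
      -- be 0; hence a bound by 1 and not an equality.
      (∑-mono-≤ 𝕄 λ b → subst (_≤ 1ℤ)
        (sym (𝕍-enumerates (solution b) (λ u → fibre (b +ᴹ row l u))
          λ u u≢ → ι-no (Y ≟ᴹ adj t (b +ᴹ row l u)) (λ Y≡ → u≢ (solution-unique b u Y≡))))
        (ι≤1 (does (Y ≟ᴹ adj t (b +ᴹ row l (solution b))))))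
      (ℤ.≤-reflexive (trans (∑-const 𝕄 1ℤ) (ℤ.*-identityʳ Q)))

-- The Radon transform: Plancherel identity and decorrelation.

module Radon (F : FiniteField) (n : ℕ) where
  open IntegerSums
  open import Data.Integer using (ℤ; +_; _+_; _*_; _-_; _≤_; 0ℤ; 1ℤ; +≤+; Positive; NonZero)
  open MatrixSpace F n public

  δ : Carrier → Carrier → ℤ
  δ x y = ι (does (x ≟ y))

  δ-δ : ∀ x y → ∑ 𝔽 (λ v → δ x v * δ y v) ≡ δ x y
  δ-δ x y = begin
    ∑ 𝔽 (λ v → δ x v * δ y v)
      ≡⟨ 𝔽-enumerates y _ (λ v v≢y → trans (cong (δ x v *_) (ι-no (y ≟ v) (λ y≡v → v≢y (sym y≡v)))) (ℤ.*-zeroʳ (δ x v))) ⟩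
    δ x y * δ y y   ≡⟨ cong (δ x y *_) (ι-yes (y ≟ y) refl) ⟩
    δ x y * 1ℤ      ≡⟨ ℤ.*-identityʳ _ ⟩
    δ x y           ∎
    where open ≡-Reasoning

  δ-⊝ : ∀ x y → δ (x ⊝ y) 0# ≡ δ x y
  δ-⊝ x y = ι-cong ((x ⊝ y) ≟ 0#) (x ≟ y)
    (λ x⊝y≡0 → trans (sym (⊖-⊕ y x)) (trans (cong (_⊕ y) x⊝y≡0) (⊕-identityˡ y)))
    (λ { refl → ⊖-inverseʳ x })

  δ-⊕ : ∀ x y v → δ (x ⊕ y) v ≡ δ x (v ⊝ y)
  δ-⊕ x y v = ι-cong ((x ⊕ y) ≟ v) (x ≟ (v ⊝ y)) (λ { refl → sym (⊕-⊖ y x) }) (λ { refl → ⊖-⊕ y v })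

  -- The Plancherel identity carries the factor `q - 1ℤ`, which has to be positive to be cancelled
  -- from an inequality.
  elements-≥2 : ∃ λ k → length elements ≡ suc (suc k)
  elements-≥2 with elements | complete 0# | complete 1#
  ... | x ∷ y ∷ xs | _         | _         = length xs , refl
  ... | x ∷ []     | here 0≡x  | here 1≡x  = contradiction (trans 0≡x (sym 1≡x)) 0≢1

  instance
    q-nonZero : NonZero q
    q-nonZero with length elements | elements-≥2
    ... | _ | k , refl = _

    q-1-positive : Positive (q - 1ℤ)
    q-1-positive with length elements | elements-≥2
    ... | _ | k , refl = _

  -- If `X` were missing from the list, the sum of its indicator would be 0 by absence and 1 by
  -- `𝕄-enumerates`.
  ∈-𝕄 : ∀ X → X ∈ 𝕄
  ∈-𝕄 X with DecMembership._∈?_ _≟ᴹ_ X 𝕄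
  ... | yes X∈ = X∈
  ... | no  X∉ = contradiction
    (trans (sym (∑-absent 𝕄 X∉ (λ Y Y≢X → ι-no (Y ≟ᴹ X) Y≢X)))
           (trans (𝕄-enumerates X (λ Y → ι (does (Y ≟ᴹ X))) (λ Y Y≢X → ι-no (Y ≟ᴹ X) Y≢X)) (ι-yes (X ≟ᴹ X) refl)))
    λ ()

  instance
    Q-positive : Positive Q
    Q-positive with 𝕄 | ∈-𝕄 0ᴹ
    ... | _ ∷ _ | _ = _

  -- An integer substitute for the Fourier transform: a Fourier transform in `v` would turn
  -- `radon f t` into the coefficients of `f` at the scalar multiples of `t`.
  radon : (M → ℤ) → M → Carrier → ℤ
  radon f t v = ∑ 𝕄 (λ s → f s * δ ⟪ t , s ⟫ v)

  ∑-radon : ∀ f t → ∑ 𝔽 (radon f t) ≡ ∑ 𝕄 f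
  ∑-radon f t = begin
    ∑ 𝔽 (radon f t)                                   ≡⟨ ∑-swap 𝔽 𝕄 _ ⟩
    ∑ 𝕄 (λ s → ∑ 𝔽 (λ v → f s * δ ⟪ t , s ⟫ v))       ≡⟨ ∑-cong 𝕄 (λ s → ∑-*ˡ 𝔽 (f s) _) ⟩
    ∑ 𝕄 (λ s → f s * ∑ 𝔽 (δ ⟪ t , s ⟫))
      ≡⟨ ∑-cong 𝕄 (λ s → cong (f s *_) (trans
           (𝔽-enumerates ⟪ t , s ⟫ (δ ⟪ t , s ⟫) (λ v v≢ → ι-no (⟪ t , s ⟫ ≟ v) (λ ≡v → v≢ (sym ≡v))))
           (ι-yes (⟪ t , s ⟫ ≟ ⟪ t , s ⟫) refl))) ⟩
    ∑ 𝕄 (λ s → f s * 1ℤ)                              ≡⟨ ∑-cong 𝕄 (λ s → ℤ.*-identityʳ (f s)) ⟩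
    ∑ 𝕄 f                                             ∎
    where open ≡-Reasoning

  radon-0ᴹ : ∀ f → ∑ 𝕄 f ≡ 0ℤ → ∀ v → radon f 0ᴹ v ≡ 0ℤ
  radon-0ᴹ f ∑f≡0 v = begin
    ∑ 𝕄 (λ s → f s * δ ⟪ 0ᴹ , s ⟫ v)  ≡⟨ ∑-cong 𝕄 (λ s → cong (λ x → f s * δ x v) (⟪0,⟫ s)) ⟩
    ∑ 𝕄 (λ s → f s * δ 0# v)          ≡⟨ ∑-*ʳ 𝕄 (δ 0# v) f ⟩
    ∑ 𝕄 f * δ 0# v                    ≡⟨ cong (_* δ 0# v) ∑f≡0 ⟩
    0ℤ * δ 0# v                       ≡⟨ ℤ.*-zeroˡ (δ 0# v) ⟩
    0ℤ                                ∎
    where open ≡-Reasoning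

  collisions : M → M → ℤ
  collisions s s′ = ∑ 𝕄 (λ t → δ ⟪ t , s ⟫ ⟪ t , s′ ⟫)

  -- For distinct `s` and `s′` the value ⟨t, s - s′⟩ is equidistributed over the field, so it is 0
  -- for a proportion 1/q of all `t`; on the diagonal every `t` counts. The factor `q` keeps this
  -- integral.
  q*collisions : ∀ s s′ → q * collisions s s′ ≡ Q + (q - 1ℤ) * Q * ι (does (s ≟ᴹ s′))
  q*collisions s s′ with s ≟ᴹ s′
  ... | yes refl = begin
    q * collisions s s      ≡⟨ cong (q *_) (∑-cong 𝕄 λ t → ι-yes (⟪ t , s ⟫ ≟ ⟪ t , s ⟫) refl) ⟩
    q * ∑ 𝕄 (λ _ → 1ℤ)      ≡⟨ cong (q *_) (∑-const 𝕄 1ℤ) ⟩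
    q * (Q * 1ℤ)            ≡⟨ split q Q ⟩
    Q + (q - 1ℤ) * Q * 1ℤ   ∎
    where
    open ≡-Reasoning
    split : ∀ a b → a * (b * 1ℤ) ≡ b + (a - 1ℤ) * b * 1ℤ
    split = solve-∀
  ... | no s≢s′ = begin
    q * collisions s s′
      ≡⟨ cong (q *_) (∑-cong 𝕄 λ t → trans (sym (δ-⊝ ⟪ t , s ⟫ ⟪ t , s′ ⟫))
           (cong₂ (λ x y → δ (x ⊝ y) 0#) (⟪⟫-comm t s) (⟪⟫-comm t s′))) ⟩
    q * ∑ 𝕄 (λ t → δ (⟪ s , t ⟫ ⊝ ⟪ s′ , t ⟫) 0#)
      ≡⟨ equidistribution s≢s′ (λ x → δ x 0#) ⟩
    Q * ∑ 𝔽 (λ x → δ x 0#)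
      ≡⟨ cong (Q *_) (trans (𝔽-enumerates 0# (λ x → δ x 0#) (λ x → ι-no (x ≟ 0#))) (ι-yes (0# ≟ 0#) refl)) ⟩
    Q * 1ℤ
      ≡⟨ pad q Q ⟩
    Q + (q - 1ℤ) * Q * 0ℤ  ∎
    where
    open ≡-Reasoning
    pad : ∀ a b → b * 1ℤ ≡ b + (a - 1ℤ) * b * 0ℤ
    pad = solve-∀

  -- After expansion into pairs, the part of `q*collisions` that is constant in `s` and `s′`
  -- contributes `Q` times the square of the total of `f`, which is 0. Only the diagonal survives.
  plancherel : ∀ f → ∑ 𝕄 f ≡ 0ℤ → q * ∑ 𝕄 (λ t → energy 𝔽 (radon f t)) ≡ (q - 1ℤ) * Q * energy 𝕄 f
  plancherel f ∑f≡0 = begin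
    q * ∑ 𝕄 (λ t → energy 𝔽 (radon f t))
      ≡⟨ cong (q *_) (∑-cong 𝕄 λ t → trans (gram 𝔽 𝕄 f (λ s → δ ⟪ t , s ⟫))
           (∑-cong 𝕄 λ s → ∑-cong 𝕄 λ s′ → cong (f s * f s′ *_) (δ-δ ⟪ t , s ⟫ ⟪ t , s′ ⟫))) ⟩
    q * ∑ 𝕄 (λ t → ∑ 𝕄 (λ s → ∑ 𝕄 (λ s′ → f s * f s′ * δ ⟪ t , s ⟫ ⟪ t , s′ ⟫)))
      ≡⟨ cong (q *_) (trans (∑-swap 𝕄 𝕄 _) (∑-cong 𝕄 λ s → ∑-swap 𝕄 𝕄 _)) ⟩
    q * ∑ 𝕄 (λ s → ∑ 𝕄 (λ s′ → ∑ 𝕄 (λ t → f s * f s′ * δ ⟪ t , s ⟫ ⟪ t , s′ ⟫)))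
      ≡⟨ cong (q *_) (∑-cong 𝕄 λ s → ∑-cong 𝕄 λ s′ → ∑-*ˡ 𝕄 (f s * f s′) _) ⟩
    q * ∑ 𝕄 (λ s → ∑ 𝕄 (λ s′ → f s * f s′ * collisions s s′))
      ≡⟨ trans (sym (∑-*ˡ 𝕄 q _)) (∑-cong 𝕄 λ s → sym (∑-*ˡ 𝕄 q _)) ⟩
    ∑ 𝕄 (λ s → ∑ 𝕄 (λ s′ → q * (f s * f s′ * collisions s s′)))
      ≡⟨ ∑-cong 𝕄 (λ s → ∑-cong 𝕄 λ s′ → expand s s′) ⟩
    ∑ 𝕄 (λ s → ∑ 𝕄 (λ s′ → Q * f s * f s′ + k * (f s * f s′ * ι (does (s ≟ᴹ s′)))))
      ≡⟨ ∑-cong 𝕄 (λ s → trans (∑-+ 𝕄 _ _) (cong₂ _+_ (off s) (diag s))) ⟩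
    ∑ 𝕄 (λ s → 0ℤ + k * (f s * f s))
      ≡⟨ ∑-cong 𝕄 (λ s → ℤ.+-identityˡ _) ⟩
    ∑ 𝕄 (λ s → k * (f s * f s))
      ≡⟨ ∑-*ˡ 𝕄 k _ ⟩
    k * energy 𝕄 f  ∎
    where
    open ≡-Reasoning
    k : ℤ
    k = (q - 1ℤ) * Q

    pull : ∀ a b c d → a * (b * c * d) ≡ b * c * (a * d)
    pull = solve-∀

    distribute : ∀ a b Q k d → a * b * (Q + k * d) ≡ Q * a * b + k * (a * b * d)
    distribute = solve-∀

    expand : ∀ s s′ → q * (f s * f s′ * collisions s s′) ≡ Q * f s * f s′ + k * (f s * f s′ * ι (does (s ≟ᴹ s′)))
    expand s s′ = trans (pull q (f s) (f s′) (collisions s s′))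
      (trans (cong (f s * f s′ *_) (q*collisions s s′)) (distribute (f s) (f s′) Q k (ι (does (s ≟ᴹ s′)))))

    off : ∀ s → ∑ 𝕄 (λ s′ → Q * f s * f s′) ≡ 0ℤ
    off s = trans (∑-*ˡ 𝕄 (Q * f s) f) (trans (cong (Q * f s *_) ∑f≡0) (ℤ.*-zeroʳ (Q * f s)))

    diag : ∀ s → ∑ 𝕄 (λ s′ → k * (f s * f s′ * ι (does (s ≟ᴹ s′)))) ≡ k * (f s * f s)
    diag s = trans (∑-*ˡ 𝕄 k _) (cong (k *_) (trans
      (𝕄-enumerates s (λ s′ → f s * f s′ * ι (does (s ≟ᴹ s′)))
        (λ s′ s′≢s → trans (cong (f s * f s′ *_) (ι-no (s ≟ᴹ s′) (λ s≡s′ → s′≢s (sym s≡s′)))) (ℤ.*-zeroʳ (f s * f s′))))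
      (trans (cong (f s * f s *_) (ι-yes (s ≟ᴹ s) refl)) (ℤ.*-identityʳ (f s * f s)))))

  ∑𝔽-unshift : ∀ x (f : Carrier → ℤ) → ∑ 𝔽 (λ v → f (v ⊝ x)) ≡ ∑ 𝔽 f
  ∑𝔽-unshift x = ∑𝔽-shift (⊖ x)

  -- For `X` ≢ `Y` the relative shift ⟨X - Y, c⟩ takes all values equally often, so the sum over `c`
  -- is proportional to the square of the total of `G`, that is 0. For equal arguments the two
  -- shifts agree and a translation of `v` removes them.
  correlation : ∀ (G : Carrier → ℤ) → ∑ 𝔽 G ≡ 0ℤ → ∀ X Y →
    ∑ 𝕄 (λ c → ∑ 𝔽 (λ v → G (v ⊝ ⟪ X , c ⟫) * G (v ⊝ ⟪ Y , c ⟫))) ≡ ι (does (X ≟ᴹ Y)) * (Q * energy 𝔽 G)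
  correlation G ∑G≡0 X Y with X ≟ᴹ Y
  ... | yes refl = begin
    ∑ 𝕄 (λ c → ∑ 𝔽 (λ v → G (v ⊝ ⟪ X , c ⟫) * G (v ⊝ ⟪ X , c ⟫)))
      ≡⟨ ∑-cong 𝕄 (λ c → ∑𝔽-unshift ⟪ X , c ⟫ (λ v → G v * G v)) ⟩
    ∑ 𝕄 (λ c → energy 𝔽 G)   ≡⟨ ∑-const 𝕄 _ ⟩
    Q * energy 𝔽 G           ≡⟨ ℤ.*-identityˡ _ ⟨
    1ℤ * (Q * energy 𝔽 G)    ∎
    where open ≡-Reasoning
  ... | no X≢Y = trans (ℤ.*-cancelˡ-≡ q _ 0ℤ (begin
    q * ∑ 𝕄 (λ c → ∑ 𝔽 (λ v → G (v ⊝ ⟪ X , c ⟫) * G (v ⊝ ⟪ Y , c ⟫)))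
      ≡⟨ cong (q *_) (∑-cong 𝕄 λ c → recentre ⟪ X , c ⟫ ⟪ Y , c ⟫) ⟩
    q * ∑ 𝕄 (λ c → H (⟪ X , c ⟫ ⊝ ⟪ Y , c ⟫))
      ≡⟨ equidistribution X≢Y H ⟩
    Q * ∑ 𝔽 H
      ≡⟨ cong (Q *_) ∑H≡0 ⟩
    Q * 0ℤ
      ≡⟨ trans (ℤ.*-zeroʳ Q) (sym (ℤ.*-zeroʳ q)) ⟩
    q * 0ℤ  ∎)) (sym (ℤ.*-zeroˡ (Q * energy 𝔽 G)))
    where
    open ≡-Reasoning
    -- The autocorrelation of `G`: after recentring, the sum over `v` depends only on the difference
    -- of the two shifts, as `equidistribution` requires.
    H : Carrier → ℤ
    H w = ∑ 𝔽 (λ v → G v * G (v ⊕ w))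

    recentre : ∀ x y → ∑ 𝔽 (λ v → G (v ⊝ x) * G (v ⊝ y)) ≡ H (x ⊝ y)
    recentre x y = trans (sym (∑𝔽-shift x (λ v → G (v ⊝ x) * G (v ⊝ y))))
      (∑-cong 𝔽 λ v → cong₂ (λ a b → G a * G b) (⊕-⊖ x v) (⊕-assoc v x (⊖ y)))

    ∑H≡0 : ∑ 𝔽 H ≡ 0ℤ
    ∑H≡0 = trans (∑-swap 𝔽 𝔽 _) (∑-zero 𝔽 λ v → begin
      ∑ 𝔽 (λ w → G v * G (v ⊕ w))   ≡⟨ ∑-*ˡ 𝔽 (G v) _ ⟩
      G v * ∑ 𝔽 (λ w → G (v ⊕ w))   ≡⟨ cong (G v *_) (∑-cong 𝔽 λ w → cong G (⊕-comm v w)) ⟩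
      G v * ∑ 𝔽 (λ w → G (w ⊕ v))   ≡⟨ cong (G v *_) (trans (∑𝔽-shift v G) ∑G≡0) ⟩
      G v * 0ℤ                      ≡⟨ ℤ.*-zeroʳ (G v) ⟩
      0ℤ                            ∎)

  -- The second moment of the convolution.

  module Convolution (B : M → Bool) (g : M → ℤ) (∑g≡0 : ∑ 𝕄 g ≡ 0ℤ) where

    |B| : ℤ
    |B| = ∑ 𝕄 (λ b → ι (B b))

    conv : M → M → ℤ
    conv c s = ∑ 𝕄 (λ b → ι (B b) * g (s -ᴹ (b *ᴹ c)))

    ∑-conv : ∀ c → ∑ 𝕄 (conv c) ≡ 0ℤ
    ∑-conv c = trans (∑-swap 𝕄 𝕄 _) (∑-zero 𝕄 λ b → begin
      ∑ 𝕄 (λ s → ι (B b) * g (s -ᴹ (b *ᴹ c)))  ≡⟨ ∑-*ˡ 𝕄 (ι (B b)) _ ⟩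
      ι (B b) * ∑ 𝕄 (λ s → g (s -ᴹ (b *ᴹ c)))  ≡⟨ cong (ι (B b) *_) (trans (∑𝕄-unshift (b *ᴹ c) g) ∑g≡0) ⟩
      ι (B b) * 0ℤ                             ≡⟨ ℤ.*-zeroʳ (ι (B b)) ⟩
      0ℤ                                       ∎)
      where open ≡-Reasoning

    radon-translate : ∀ t X v → ∑ 𝕄 (λ s → g (s -ᴹ X) * δ ⟪ t , s ⟫ v) ≡ radon g t (v ⊝ ⟪ t , X ⟫)
    radon-translate t X v = begin
      ∑ 𝕄 (λ s → g (s -ᴹ X) * δ ⟪ t , s ⟫ v)
        ≡⟨ ∑𝕄-shift X (λ s → g (s -ᴹ X) * δ ⟪ t , s ⟫ v) ⟨
      ∑ 𝕄 (λ s → g ((s +ᴹ X) -ᴹ X) * δ ⟪ t , s +ᴹ X ⟫ v)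
        ≡⟨ ∑-cong 𝕄 (λ s → cong₂ _*_ (cong g (+ᴹ--ᴹ s X))
             (trans (cong (λ x → δ x v) (⟪⟫-+ʳ t s X)) (δ-⊕ ⟪ t , s ⟫ ⟪ t , X ⟫ v))) ⟩
      radon g t (v ⊝ ⟪ t , X ⟫)  ∎
      where open ≡-Reasoning

    -- Translating a function by bc merely shifts its transform in `v`, and moving `b` across the
    -- pairing leaves `c` alone in the second slot. This is the shape to which `correlation`
    -- applies.
    radon-conv : ∀ c t v → radon (conv c) t v ≡ ∑ 𝕄 (λ b → ι (B b) * radon g t (v ⊝ ⟪ adj t b , c ⟫))
    radon-conv c t v = begin
      ∑ 𝕄 (λ s → conv c s * δ ⟪ t , s ⟫ v)
        ≡⟨ ∑-cong 𝕄 (λ s → ∑-*ʳ 𝕄 (δ ⟪ t , s ⟫ v) _) ⟨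
      ∑ 𝕄 (λ s → ∑ 𝕄 (λ b → ι (B b) * g (s -ᴹ (b *ᴹ c)) * δ ⟪ t , s ⟫ v))
        ≡⟨ ∑-swap 𝕄 𝕄 _ ⟩
      ∑ 𝕄 (λ b → ∑ 𝕄 (λ s → ι (B b) * g (s -ᴹ (b *ᴹ c)) * δ ⟪ t , s ⟫ v))
        ≡⟨ ∑-cong 𝕄 (λ b → trans (∑-cong 𝕄 λ s → ℤ.*-assoc (ι (B b)) _ _) (∑-*ˡ 𝕄 (ι (B b)) _)) ⟩
      ∑ 𝕄 (λ b → ι (B b) * ∑ 𝕄 (λ s → g (s -ᴹ (b *ᴹ c)) * δ ⟪ t , s ⟫ v))
        ≡⟨ ∑-cong 𝕄 (λ b → cong (ι (B b) *_) (trans (radon-translate t (b *ᴹ c) v)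
             (cong (λ x → radon g t (v ⊝ x)) (⟪,*⟫ t b c)))) ⟩
      ∑ 𝕄 (λ b → ι (B b) * radon g t (v ⊝ ⟪ adj t b , c ⟫))  ∎
      where open ≡-Reasoning

    same-adj : M → M → ℤ
    same-adj t b = ∑ 𝕄 (λ b′ → ι (B b′) * ι (does (adj t b ≟ᴹ adj t b′)))

    -- `gram` produces pairs `b`, `b′`; the complete sum over `c` then lets `correlation` delete
    -- every pair with bᵀt ≠ b′ᵀt. The outcome is exact, and losses begin only with the fibre count.
    ∑-energy-radon : ∀ t → ∑ 𝕄 (λ c → energy 𝔽 (radon (conv c) t))
                         ≡ Q * energy 𝔽 (radon g t) * ∑ 𝕄 (λ b → ι (B b) * same-adj t b)
    ∑-energy-radon t = begin
      ∑ 𝕄 (λ c → energy 𝔽 (radon (conv c) t))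
        ≡⟨ ∑-cong 𝕄 (λ c → ∑-cong 𝔽 λ v → cong₂ _*_ (radon-conv c t v) (radon-conv c t v)) ⟩
      ∑ 𝕄 (λ c → ∑ 𝔽 (λ v → ∑ 𝕄 (λ b → β b * K b c v) * ∑ 𝕄 (λ b → β b * K b c v)))
        ≡⟨ ∑-cong 𝕄 (λ c → gram 𝔽 𝕄 β (λ b → K b c)) ⟩
      ∑ 𝕄 (λ c → ∑ 𝕄 (λ b → ∑ 𝕄 (λ b′ → β b * β b′ * ∑ 𝔽 (λ v → K b c v * K b′ c v))))
        ≡⟨ trans (∑-swap 𝕄 𝕄 _) (∑-cong 𝕄 λ b → ∑-swap 𝕄 𝕄 _) ⟩
      ∑ 𝕄 (λ b → ∑ 𝕄 (λ b′ → ∑ 𝕄 (λ c → β b * β b′ * ∑ 𝔽 (λ v → K b c v * K b′ c v))))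
        ≡⟨ ∑-cong 𝕄 (λ b → ∑-cong 𝕄 λ b′ → trans (∑-*ˡ 𝕄 (β b * β b′) _)
             (cong (β b * β b′ *_) (correlation (radon g t) (trans (∑-radon g t) ∑g≡0) (adj t b) (adj t b′)))) ⟩
      ∑ 𝕄 (λ b → ∑ 𝕄 (λ b′ → β b * β b′ * (same b b′ * E)))
        ≡⟨ ∑-cong 𝕄 (λ b → trans (∑-cong 𝕄 λ b′ → pull (β b) (β b′) (same b b′) E) (∑-*ˡ 𝕄 (E * β b) _)) ⟩
      ∑ 𝕄 (λ b → E * β b * same-adj t b)
        ≡⟨ trans (∑-cong 𝕄 λ b → ℤ.*-assoc E (β b) (same-adj t b)) (∑-*ˡ 𝕄 E _) ⟩
      E * ∑ 𝕄 (λ b → β b * same-adj t b)  ∎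
      where
      open ≡-Reasoning
      β : M → ℤ
      β b = ι (B b)
      K : M → M → Carrier → ℤ
      K b c v = radon g t (v ⊝ ⟪ adj t b , c ⟫)
      same : M → M → ℤ
      same b b′ = ι (does (adj t b ≟ᴹ adj t b′))
      E : ℤ
      E = Q * energy 𝔽 (radon g t)
      pull : ∀ a b c d → a * b * (c * d) ≡ d * a * (b * c)
      pull = solve-∀

    same-adj-bound : ∀ {t} → t ≢ 0ᴹ → qⁿ * ∑ 𝕄 (λ b → ι (B b) * same-adj t b) ≤ Q * |B|
    same-adj-bound {t} t≢0 = begin
      qⁿ * ∑ 𝕄 (λ b → ι (B b) * same-adj t b)
        ≡⟨ ∑-*ˡ 𝕄 qⁿ _ ⟨
      ∑ 𝕄 (λ b → qⁿ * (ι (B b) * same-adj t b))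
        ≤⟨ ∑-mono-≤ 𝕄 pointwise ⟩
      ∑ 𝕄 (λ b → Q * ι (B b))
        ≡⟨ ∑-*ˡ 𝕄 Q _ ⟩
      Q * |B|  ∎
      where
      open ℤ.≤-Reasoning
      pull : ∀ a b c → a * (b * c) ≡ b * (a * c)
      pull = solve-∀

      fibre-bound : ∀ b → qⁿ * same-adj t b ≤ Q
      fibre-bound b = ℤ.≤-trans
        -- Membership of `b′` in B is forgotten, so that a whole fibre of b′ ↦ b′ᵀt is counted.
        (ℤ.*-monoˡ-≤-nonNeg qⁿ (∑-mono-≤ 𝕄 λ b′ → ι*ι≤ι (B b′) (does (adj t b ≟ᴹ adj t b′))))
        (adj-fibre t≢0 (adj t b))

      pointwise : ∀ b → qⁿ * (ι (B b) * same-adj t b) ≤ Q * ι (B b)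
      pointwise b = subst₂ _≤_ (pull (ι (B b)) qⁿ (same-adj t b)) (ℤ.*-comm (ι (B b)) Q) (*-monoˡ-≤-0≤ (0≤ι (B b)) (fibre-bound b))

    -- For nonzero `t` this is the fibre count. At 0 that count breaks down, but the transform of
    -- `g` vanishes there, so both sides are 0.
    energy-radon-bound : ∀ t → qⁿ * ∑ 𝕄 (λ c → energy 𝔽 (radon (conv c) t)) ≤ Q * Q * |B| * energy 𝔽 (radon g t)
    energy-radon-bound t with t ≟ᴹ 0ᴹ
    ... | no t≢0 = begin
      qⁿ * ∑ 𝕄 (λ c → energy 𝔽 (radon (conv c) t))
        ≡⟨ cong (qⁿ *_) (∑-energy-radon t) ⟩
      qⁿ * (Q * E * Σb)
        ≡⟨ pull qⁿ Q E Σb ⟩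
      Q * E * (qⁿ * Σb)
        ≤⟨ *-monoˡ-≤-0≤ (0≤* {Q} (+≤+ z≤n) (energy-nonneg 𝔽 (radon g t))) (same-adj-bound t≢0) ⟩
      Q * E * (Q * |B|)
        ≡⟨ rearrange Q E |B| ⟩
      Q * Q * |B| * E  ∎
      where
      open ℤ.≤-Reasoning
      E Σb : ℤ
      E = energy 𝔽 (radon g t)
      Σb = ∑ 𝕄 (λ b → ι (B b) * same-adj t b)
      pull : ∀ a b c d → a * (b * c * d) ≡ b * c * (a * d)
      pull = solve-∀
      rearrange : ∀ a b c → a * b * (a * c) ≡ a * a * c * b
      rearrange = solve-∀
    ... | yes refl = ℤ.≤-reflexive (trans (cong (qⁿ *_) (trans (∑-energy-radon 0ᴹ) (cong (λ e → Q * e * Σb) E≡0)))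
                       (trans (vanish qⁿ Q Σb) (sym (trans (cong (Q * Q * |B| *_) E≡0) (ℤ.*-zeroʳ (Q * Q * |B|))))))
      where
      Σb : ℤ
      Σb = ∑ 𝕄 (λ b → ι (B b) * same-adj 0ᴹ b)
      E≡0 : energy 𝔽 (radon g 0ᴹ) ≡ 0ℤ
      E≡0 = ∑-zero 𝔽 λ v → cong₂ _*_ (radon-0ᴹ g ∑g≡0 v) (radon-0ᴹ g ∑g≡0 v)
      vanish : ∀ a b c → a * (b * 0ℤ * c) ≡ 0ℤ
      vanish = solve-∀

    -- Plancherel is applied to every `conv c` on one side and to `g` on the other, with the bound
    -- for each `t` in between. Its factor `(q - 1ℤ) * Q` appears on both sides and cancels.
    ∑-energy-conv : qⁿ * ∑ 𝕄 (λ c → energy 𝕄 (conv c)) ≤ Q * Q * |B| * energy 𝕄 g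
    ∑-energy-conv = ℤ.*-cancelˡ-≤-pos _ _ Q (ℤ.*-cancelˡ-≤-pos _ _ (q - 1ℤ) (begin
      (q - 1ℤ) * (Q * (qⁿ * ∑ 𝕄 (λ c → energy 𝕄 (conv c))))
        ≡⟨ pull (q - 1ℤ) Q qⁿ _ ⟩
      qⁿ * ((q - 1ℤ) * Q * ∑ 𝕄 (λ c → energy 𝕄 (conv c)))
        ≡⟨ cong (qⁿ *_) (trans (sym (∑-*ˡ 𝕄 ((q - 1ℤ) * Q) _)) (∑-cong 𝕄 λ c → sym (plancherel (conv c) (∑-conv c)))) ⟩
      qⁿ * ∑ 𝕄 (λ c → q * ∑ 𝕄 (λ t → energy 𝔽 (radon (conv c) t)))
        ≡⟨ cong (qⁿ *_) (trans (∑-*ˡ 𝕄 q _) (cong (q *_) (∑-swap 𝕄 𝕄 _))) ⟩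
      qⁿ * (q * ∑ 𝕄 (λ t → ∑ 𝕄 (λ c → energy 𝔽 (radon (conv c) t))))
        ≡⟨ trans (swap qⁿ q _) (cong (q *_) (sym (∑-*ˡ 𝕄 qⁿ _))) ⟩
      q * ∑ 𝕄 (λ t → qⁿ * ∑ 𝕄 (λ c → energy 𝔽 (radon (conv c) t)))
        ≤⟨ ℤ.*-monoˡ-≤-nonNeg q (∑-mono-≤ 𝕄 energy-radon-bound) ⟩
      q * ∑ 𝕄 (λ t → Q * Q * |B| * energy 𝔽 (radon g t))
        ≡⟨ trans (cong (q *_) (∑-*ˡ 𝕄 (Q * Q * |B|) _)) (swap q (Q * Q * |B|) _) ⟩
      Q * Q * |B| * (q * ∑ 𝕄 (λ t → energy 𝔽 (radon g t)))
        ≡⟨ cong (Q * Q * |B| *_) (plancherel g ∑g≡0) ⟩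
      Q * Q * |B| * ((q - 1ℤ) * Q * energy 𝕄 g)
        ≡⟨ pull (q - 1ℤ) Q (Q * Q * |B|) (energy 𝕄 g) ⟨
      (q - 1ℤ) * (Q * (Q * Q * |B| * energy 𝕄 g))  ∎))
      where
      open ℤ.≤-Reasoning
      pull : ∀ a b c d → a * (b * (c * d)) ≡ c * (a * b * d)
      pull = solve-∀
      swap : ∀ a b c → a * (b * c) ≡ b * (a * c)
      swap = solve-∀

-- Numbers of vectors and matrices as powers of the field size.

length-concatMap-const : {X Y : Set} (h : X → List Y) {k : ℕ} → (∀ x → length (h x) ≡ k) →
                         ∀ xs → length (concatMap h xs) ≡ length xs ℕ.* k
length-concatMap-const h h≡k []       = refl
length-concatMap-const h h≡k (x ∷ xs) = trans (length-++ (h x)) (cong₂ ℕ._+_ (h≡k x) (length-concatMap-const h h≡k xs))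

length-allVecs : (F : FiniteField) {X : Set} (xs : List X) (m : ℕ) → length (allVecs F xs m) ≡ length xs ℕ.^ m
length-allVecs F xs zero    = refl
length-allVecs F xs (suc m) = length-concatMap-const (λ x → map (x ∷_) (allVecs F xs m))
  (λ x → trans (length-map (x ∷_) (allVecs F xs m)) (length-allVecs F xs m)) xs

length-allMatrices : (F : FiniteField) (n : ℕ) → length (allMatrices F n) ≡ FiniteField.size F ℕ.^ (n ℕ.* n)
length-allMatrices F n = trans (length-allVecs F (allVecs F (FiniteField.elements F) n) n)
  (trans (cong (ℕ._^ n) (length-allVecs F (FiniteField.elements F) n)) (ℕ.^-*-assoc (FiniteField.size F) n n))

-- Lower bound for A + BC from the second moment.

module SumProduct (F : FiniteField) (n : ℕ) (A B C : MSubset F n) where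
  open IntegerSums
  open import Data.Integer using (ℤ; +_; _+_; _*_; -_; _-_; _≤_; 0ℤ; 1ℤ; +≤+; NonNegative; nonNegative)
  open Radon F n

  S : MSubset F n
  S = sumProd F A B C

  α γ σ : ℤ
  α = + card F A
  γ = + card F C
  σ = + card F S

  ∈-sumProd : ∀ {s b c} → T (A (s -ᴹ (b *ᴹ c))) → T (B b) → T (C c) → T (S s)
  ∈-sumProd {s} {b} {c} Aa Bb Cc =
    any⁺ _ (lose (∈-𝕄 (s -ᴹ (b *ᴹ c))) (any⁺ _ (lose (∈-𝕄 b) (any⁺ _ (lose (∈-𝕄 c)
      (T-∧ .from (Aa , T-∧ .from (Bb , T-∧ .from (Cc ,
        T-≡ .from (dec-true (s ≟ᴹ ((s -ᴹ (b *ᴹ c)) +ᴹ (b *ᴹ c))) (sym (-ᴹ-+ᴹ s (b *ᴹ c)))))))))))))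
    where open Equivalence using (from)

  g : M → ℤ
  g s = Q * ι (A s) - α

  ∑-A : ∑ 𝕄 (λ s → ι (A s)) ≡ α
  ∑-A = sym (length-filterᵇ A 𝕄)

  -- The weight is left free because several are needed: the constant 1 gives the total of `g`, `g`
  -- itself and the indicator of A give its energy, and the indicator of `S` gives the mass on `S`.
  ∑-affine : (w : M → ℤ) (a : M → ℤ) → ∑ 𝕄 (λ s → w s * (Q * a s - α)) ≡ Q * ∑ 𝕄 (λ s → w s * a s) - α * ∑ 𝕄 w
  ∑-affine w a = begin
    ∑ 𝕄 (λ s → w s * (Q * a s - α))
      ≡⟨ ∑-cong 𝕄 (λ s → expand (w s) Q (a s) α) ⟩
    ∑ 𝕄 (λ s → Q * (w s * a s) + - α * w s)
      ≡⟨ ∑-+ 𝕄 _ _ ⟩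
    ∑ 𝕄 (λ s → Q * (w s * a s)) + ∑ 𝕄 (λ s → - α * w s)
      ≡⟨ cong₂ _+_ (∑-*ˡ 𝕄 Q _) (∑-*ˡ 𝕄 (- α) w) ⟩
    Q * ∑ 𝕄 (λ s → w s * a s) + - α * ∑ 𝕄 w
      ≡⟨ cong (_+_ (Q * ∑ 𝕄 (λ s → w s * a s))) (ℤ.neg-distribˡ-* α (∑ 𝕄 w)) ⟨
    Q * ∑ 𝕄 (λ s → w s * a s) - α * ∑ 𝕄 w  ∎
    where
    open ≡-Reasoning
    expand : ∀ w Q a α → w * (Q * a - α) ≡ Q * (w * a) + - α * w
    expand = solve-∀

  ∑-g : ∑ 𝕄 g ≡ 0ℤ
  ∑-g = begin
    ∑ 𝕄 g                                            ≡⟨ ∑-cong 𝕄 (λ s → ℤ.*-identityˡ (g s)) ⟨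
    ∑ 𝕄 (λ s → 1ℤ * g s)                             ≡⟨ ∑-affine (λ _ → 1ℤ) (λ s → ι (A s)) ⟩
    Q * ∑ 𝕄 (λ s → 1ℤ * ι (A s)) - α * ∑ 𝕄 (λ _ → 1ℤ)
      ≡⟨ cong₂ (λ x y → Q * x - α * y) (trans (∑-cong 𝕄 λ s → ℤ.*-identityˡ _) ∑-A) (∑-const 𝕄 1ℤ) ⟩
    Q * α - α * (Q * 1ℤ)                             ≡⟨ cancel Q α ⟩
    0ℤ                                               ∎
    where
    open ≡-Reasoning
    cancel : ∀ a b → a * b - b * (a * 1ℤ) ≡ 0ℤ
    cancel = solve-∀

  energy-g : energy 𝕄 g ≤ Q * Q * α
  energy-g = begin
    energy 𝕄 g                                     ≡⟨ ∑-affine g (λ s → ι (A s)) ⟩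
    Q * ∑ 𝕄 (λ s → g s * ι (A s)) - α * ∑ 𝕄 g
      ≡⟨ cong₂ (λ x y → Q * x - α * y) (trans (∑-cong 𝕄 λ s → ℤ.*-comm (g s) (ι (A s))) (∑-affine (λ s → ι (A s)) (λ s → ι (A s)))) ∑-g ⟩
    Q * (Q * ∑ 𝕄 (λ s → ι (A s) * ι (A s)) - α * ∑ 𝕄 (λ s → ι (A s))) - α * 0ℤ
      ≡⟨ cong₂ (λ x y → Q * (Q * x - α * y) - α * 0ℤ) (trans (∑-cong 𝕄 λ s → ι-idem (A s)) ∑-A) ∑-A ⟩
    Q * (Q * α - α * α) - α * 0ℤ                   ≡⟨ simplify Q α ⟩
    Q * Q * α - Q * (α * α)                        ≤⟨ ℤ.i≤j⇒i-k≤j (Q * (α * α)) {{nonNeg}} ℤ.≤-refl ⟩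
    Q * Q * α                                      ∎
    where
    open ℤ.≤-Reasoning
    nonNeg : NonNegative (Q * (α * α))
    nonNeg = nonNegative (0≤* {Q} (+≤+ z≤n) (square-nonneg α))
    simplify : ∀ a b → a * (a * b - b * b) - b * 0ℤ ≡ a * a * b - a * (b * b)
    simplify = solve-∀

  open Convolution B g ∑-g

  -- The translate A + bc lies inside `S`, so restricting its indicator to `S` loses nothing.
  support : ∀ {b c} → T (B b) → T (C c) → ∀ s → ι (S s) * ι (A (s -ᴹ (b *ᴹ c))) ≡ ι (A (s -ᴹ (b *ᴹ c)))
  support {b} {c} Bb Cc s with A (s -ᴹ (b *ᴹ c)) in eq
  ... | false = ℤ.*-zeroʳ (ι (S s))
  ... | true  = cong (λ x → ι x * 1ℤ) (T-≡ .to (∈-sumProd {s} {b} {c} (T-≡ .from eq) Bb Cc))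
    where open Equivalence using (to; from)

  -- Over all matrices the translated `g` sums to 0. Restriction to `S` keeps the whole positive
  -- part `Q * α` but only `σ` of the `Q` constants `- α`; the surplus measures how much `S` misses.
  total-on-S : ∀ {b c} → T (B b) → T (C c) → ∑ 𝕄 (λ s → ι (S s) * g (s -ᴹ (b *ᴹ c))) ≡ α * (Q - σ)
  total-on-S {b} {c} Bb Cc = begin
    ∑ 𝕄 (λ s → ι (S s) * g (s -ᴹ (b *ᴹ c)))
      ≡⟨ ∑-affine (λ s → ι (S s)) (λ s → ι (A (s -ᴹ (b *ᴹ c)))) ⟩
    Q * ∑ 𝕄 (λ s → ι (S s) * ι (A (s -ᴹ (b *ᴹ c)))) - α * ∑ 𝕄 (λ s → ι (S s))
      ≡⟨ cong₂ (λ x y → Q * x - α * y)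
           (trans (∑-cong 𝕄 (support Bb Cc)) (trans (∑𝕄-unshift (b *ᴹ c) (λ s → ι (A s))) ∑-A))
           (sym (length-filterᵇ S 𝕄)) ⟩
    Q * α - α * σ
      ≡⟨ factor Q α σ ⟩
    α * (Q - σ)  ∎
    where
    open ≡-Reasoning
    factor : ∀ a b c → a * b - b * c ≡ b * (a - c)
    factor = solve-∀

  conv-on-S : ∀ {c} → T (C c) → ∑ 𝕄 (λ s → ι (S s) * conv c s) ≡ |B| * (α * (Q - σ))
  conv-on-S {c} Cc = begin
    ∑ 𝕄 (λ s → ι (S s) * conv c s)
      ≡⟨ ∑-cong 𝕄 (λ s → ∑-*ˡ 𝕄 (ι (S s)) _) ⟨
    ∑ 𝕄 (λ s → ∑ 𝕄 (λ b → ι (S s) * (ι (B b) * g (s -ᴹ (b *ᴹ c)))))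
      ≡⟨ ∑-swap 𝕄 𝕄 _ ⟩
    ∑ 𝕄 (λ b → ∑ 𝕄 (λ s → ι (S s) * (ι (B b) * g (s -ᴹ (b *ᴹ c)))))
      ≡⟨ ∑-cong 𝕄 (λ b → trans (∑-cong 𝕄 λ s → swap (ι (S s)) (ι (B b)) (g (s -ᴹ (b *ᴹ c)))) (∑-*ˡ 𝕄 (ι (B b)) _)) ⟩
    ∑ 𝕄 (λ b → ι (B b) * ∑ 𝕄 (λ s → ι (S s) * g (s -ᴹ (b *ᴹ c))))
      ≡⟨ ∑-cong 𝕄 (λ b → ι*-cong (B b) (λ Bb → total-on-S {b} {c} Bb Cc)) ⟩
    ∑ 𝕄 (λ b → ι (B b) * (α * (Q - σ)))
      ≡⟨ ∑-*ʳ 𝕄 (α * (Q - σ)) _ ⟩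
    |B| * (α * (Q - σ))  ∎
    where
    open ≡-Reasoning
    swap : ∀ a b c → a * (b * c) ≡ b * (a * c)
    swap = solve-∀

  total : ∑ 𝕄 (λ c → ι (C c) * ∑ 𝕄 (λ s → ι (S s) * conv c s)) ≡ γ * (|B| * (α * (Q - σ)))
  total = trans (∑-cong 𝕄 λ c → ι*-cong (C c) (conv-on-S {c}))
         (trans (∑-*ʳ 𝕄 (|B| * (α * (Q - σ))) _)
                (cong (_* (|B| * (α * (Q - σ)))) (sym (length-filterᵇ C 𝕄))))

  ∑-ι² : (X : M → Bool) → ∑ 𝕄 (λ s → ι (X s) * ι (X s)) ≡ + card F X
  ∑-ι² X = trans (∑-cong 𝕄 λ s → ι-idem (X s)) (sym (length-filterᵇ X 𝕄))

  -- Cauchy-Schwarz is used twice, over `c` with the indicator of C and over `s` with the indicator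
  -- of `S`. The weights yield `γ` and `σ`, and the remaining sums of squares run over all matrices.
  total² : (γ * (|B| * (α * (Q - σ)))) * (γ * (|B| * (α * (Q - σ)))) ≤ γ * (σ * ∑ 𝕄 (λ c → energy 𝕄 (conv c)))
  total² = begin
    (γ * (|B| * (α * (Q - σ)))) * (γ * (|B| * (α * (Q - σ))))
      ≡⟨ cong₂ _*_ (sym total) (sym total) ⟩
    ∑ 𝕄 (λ c → ι (C c) * V c) * ∑ 𝕄 (λ c → ι (C c) * V c)
      ≤⟨ cauchy-schwarz 𝕄 (λ c → ι (C c)) V ⟩
    ∑ 𝕄 (λ c → ι (C c) * ι (C c)) * ∑ 𝕄 (λ c → V c * V c)
      ≡⟨ cong (_* ∑ 𝕄 (λ c → V c * V c)) (∑-ι² C) ⟩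
    γ * ∑ 𝕄 (λ c → V c * V c)
      ≤⟨ ℤ.*-monoˡ-≤-nonNeg γ (∑-mono-≤ 𝕄 λ c → ℤ.≤-trans (cauchy-schwarz 𝕄 (λ s → ι (S s)) (conv c))
           (ℤ.≤-reflexive (cong (_* energy 𝕄 (conv c)) (∑-ι² S)))) ⟩
    γ * ∑ 𝕄 (λ c → σ * energy 𝕄 (conv c))
      ≡⟨ cong (γ *_) (∑-*ˡ 𝕄 σ _) ⟩
    γ * (σ * ∑ 𝕄 (λ c → energy 𝕄 (conv c)))  ∎
    where
    open ℤ.≤-Reasoning
    V : M → ℤ
    V c = ∑ 𝕄 (λ s → ι (S s) * conv c s)

  τ : ℤ
  τ = α * |B| * γ

  -- One factor `τ` stays on the right and is not cancelled here, since `τ` is 0 when one of the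
  -- sets is empty.
  second-moment : qⁿ * ((τ * (Q - σ)) * (τ * (Q - σ))) ≤ τ * (Q * Q * (Q * Q) * σ)
  second-moment = begin
    qⁿ * ((τ * (Q - σ)) * (τ * (Q - σ)))
      ≡⟨ cong (qⁿ *_) (cong₂ _*_ (reorder α |B| γ (Q - σ)) (reorder α |B| γ (Q - σ))) ⟩
    qⁿ * ((γ * (|B| * (α * (Q - σ)))) * (γ * (|B| * (α * (Q - σ)))))
      ≤⟨ ℤ.*-monoˡ-≤-nonNeg qⁿ total² ⟩
    qⁿ * (γ * (σ * ∑ 𝕄 (λ c → energy 𝕄 (conv c))))
      ≡⟨ pull qⁿ γ σ _ ⟩
    γ * σ * (qⁿ * ∑ 𝕄 (λ c → energy 𝕄 (conv c)))
      ≤⟨ *-monoˡ-≤-0≤ (0≤* {γ} {σ} (+≤+ z≤n) (+≤+ z≤n)) ∑-energy-conv ⟩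
    γ * σ * (Q * Q * |B| * energy 𝕄 g)
      ≤⟨ *-monoˡ-≤-0≤ (0≤* {γ} {σ} (+≤+ z≤n) (+≤+ z≤n)) (*-monoˡ-≤-0≤ (0≤* (square-nonneg Q) 0≤|B|) energy-g) ⟩
    γ * σ * (Q * Q * |B| * (Q * Q * α))
      ≡⟨ collect α |B| γ σ Q ⟩
    τ * (Q * Q * (Q * Q) * σ)  ∎
    where
    open ℤ.≤-Reasoning
    0≤|B| : 0ℤ ≤ |B|
    0≤|B| = ∑-nonneg 𝕄 (λ b → 0≤ι (B b))
    reorder : ∀ a b c d → a * b * c * d ≡ c * (b * (a * d))
    reorder = solve-∀
    pull : ∀ a b c d → a * (b * (c * d)) ≡ b * c * (a * d)
    pull = solve-∀
    collect : ∀ a b c s Q → c * s * (Q * Q * b * (Q * Q * a)) ≡ a * b * c * (Q * Q * (Q * Q) * s)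
    collect = solve-∀

  -- When `S` fills at most half the space, `Q` is at most twice `Q - σ`. Squaring this 2 is the
  -- origin of the constant 4.
  product-bound : + 2 * σ ≤ Q → qⁿ * τ ≤ + 4 * (Q * Q * σ)
  product-bound 2σ≤Q = cancel τ 0≤τ (ℤ.*-cancelˡ-≤-pos _ _ Q (ℤ.*-cancelˡ-≤-pos _ _ Q (begin
    Q * (Q * (τ * (qⁿ * τ)))
      ≡⟨ pull Q τ qⁿ ⟩
    qⁿ * ((τ * Q) * (τ * Q))
      ≤⟨ ℤ.*-monoˡ-≤-nonNeg qⁿ (square-mono-≤ (0≤* 0≤τ (+≤+ z≤n)) (*-monoˡ-≤-0≤ 0≤τ Q≤2Q-2σ)) ⟩
    qⁿ * ((τ * (+ 2 * (Q - σ))) * (τ * (+ 2 * (Q - σ))))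
      ≡⟨ four qⁿ τ (Q - σ) ⟩
    + 4 * (qⁿ * ((τ * (Q - σ)) * (τ * (Q - σ))))
      ≤⟨ ℤ.*-monoˡ-≤-nonNeg (+ 4) second-moment ⟩
    + 4 * (τ * (Q * Q * (Q * Q) * σ))
      ≡⟨ collect τ Q σ ⟩
    Q * (Q * (τ * (+ 4 * (Q * Q * σ))))  ∎)))
    where
    open ℤ.≤-Reasoning
    0≤τ : 0ℤ ≤ τ
    0≤τ = 0≤* {α * |B|} {γ} (0≤* {α} (+≤+ z≤n) (∑-nonneg 𝕄 (λ b → 0≤ι (B b)))) (+≤+ z≤n)

    pull : ∀ Q τ k → Q * (Q * (τ * (k * τ))) ≡ k * ((τ * Q) * (τ * Q))
    pull = solve-∀
    four : ∀ k τ d → k * ((τ * (+ 2 * d)) * (τ * (+ 2 * d))) ≡ + 4 * (k * ((τ * d) * (τ * d)))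
    four = solve-∀
    collect : ∀ τ Q σ → + 4 * (τ * (Q * Q * (Q * Q) * σ)) ≡ Q * (Q * (τ * (+ 4 * (Q * Q * σ))))
    collect = solve-∀
    add : ∀ Q σ → + 2 * σ + (Q - + 2 * σ) ≡ Q
    add = solve-∀
    add′ : ∀ Q σ → Q + (Q - + 2 * σ) ≡ + 2 * (Q - σ)
    add′ = solve-∀

    Q≤2Q-2σ : Q ≤ + 2 * (Q - σ)
    Q≤2Q-2σ = subst₂ _≤_ (add Q σ) (add′ Q σ) (ℤ.+-monoˡ-≤ (Q - + 2 * σ) 2σ≤Q)

    square-mono-≤ : ∀ {i j} → 0ℤ ≤ i → i ≤ j → i * i ≤ j * j
    square-mono-≤ {i} {j} 0≤i i≤j =
      ℤ.≤-trans (*-monoˡ-≤-0≤ 0≤i i≤j) (subst (_≤ j * j) (ℤ.*-comm j i) (*-monoˡ-≤-0≤ (ℤ.≤-trans 0≤i i≤j) i≤j))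

    -- For `k` = 0 the claim is that 0 is below a nonnegative number; otherwise `k` is positive and
    -- may be cancelled.
    cancel : ∀ k → 0ℤ ≤ k → k * (qⁿ * k) ≤ k * (+ 4 * (Q * Q * σ)) → qⁿ * k ≤ + 4 * (Q * Q * σ)
    cancel (+ zero)  _ _ = subst (_≤ + 4 * (Q * Q * σ)) (sym (ℤ.*-zeroʳ qⁿ))
      (0≤* {+ 4} {Q * Q * σ} (+≤+ z≤n) (0≤* {Q * Q} {σ} (square-nonneg Q) (+≤+ z≤n)))
    cancel (+ suc k) _   = ℤ.*-cancelˡ-≤-pos _ _ (+ suc k)

  card-product-bound :
              2 ℕ.* card F S ℕ.≤ size ℕ.^ (n ℕ.* n) →
              size ℕ.^ n ℕ.* (card F A ℕ.* card F B ℕ.* card F C) ℕ.≤ 4 ℕ.* (size ℕ.^ (n ℕ.* n) ℕ.* size ℕ.^ (n ℕ.* n) ℕ.* card F S)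
  card-product-bound 2S≤Q = subst₂ ℕ._≤_
    (cong (ℕ._* (card F A ℕ.* card F B ℕ.* card F C)) (length-allVecs F elements n))
    (cong (λ x → 4 ℕ.* (x ℕ.* x ℕ.* card F S)) (length-allMatrices F n))
    (ℤ.drop‿+≤+ (subst₂ _≤_ lhs rhs (product-bound 2σ≤Q)))
    where
    2σ≤Q : + 2 * σ ≤ Q
    2σ≤Q = subst (_≤ Q) (ℤ.pos-* 2 (card F S)) (+≤+ (subst (2 ℕ.* card F S ℕ.≤_) (sym (length-allMatrices F n)) 2S≤Q))
    lhs : qⁿ * τ ≡ + (length 𝕍 ℕ.* (card F A ℕ.* card F B ℕ.* card F C))
    lhs = sym (trans (ℤ.pos-* (length 𝕍) _) (cong (qⁿ *_) (trans (ℤ.pos-* (card F A ℕ.* card F B) (card F C))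
      (cong (_* γ) (trans (ℤ.pos-* (card F A) (card F B)) (cong (α *_) (length-filterᵇ B 𝕄)))))))
    rhs : + 4 * (Q * Q * σ) ≡ + (4 ℕ.* (length 𝕄 ℕ.* length 𝕄 ℕ.* card F S))
    rhs = sym (trans (ℤ.pos-* 4 (length 𝕄 ℕ.* length 𝕄 ℕ.* card F S)) (cong (+ 4 *_) (trans (ℤ.pos-* (length 𝕄 ℕ.* length 𝕄) (card F S)) (cong (_* σ) (ℤ.pos-* (length 𝕄) (length 𝕄))))))

-- Exponents: the bound in natural numbers.

open import Data.Nat using (ℕ; _≤_; _∸_) renaming (_*_ to _*ℕ_; _^_ to _^ℕ_; _+_ to _+ℕ_)
open import Data.Integer using (+_)
open import Data.Rational using (ℚ; 0ℚ; _/_; _*_) renaming (_≤_ to _≤ℚ_; _<_ to _<ℚ_)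
open import Data.Product using (Σ; _×_)
open import Data.Sum using (_⊎_)
open import Algebra.Properties.CommutativeSemigroup (CommutativeMonoid.commutativeSemigroup ℚ.*-1-commutativeMonoid)
  using () renaming (interchange to ℚ-interchange)

-- Ensures that the truncated difference in the exponent 4n² ∸ (n + 1) is a genuine one.
n+1≤4n² : ∀ {n} → 1 ≤ n → n +ℕ 1 ≤ 4 *ℕ (n *ℕ n)
n+1≤4n² {n} 1≤n = begin
  n +ℕ 1             ≤⟨ ℕ.+-monoʳ-≤ n 1≤n ⟩
  n +ℕ n             ≡⟨ double n ⟩
  2 *ℕ (1 *ℕ n)      ≤⟨ ℕ.*-mono-≤ (ℕ.m≤m+n 2 2) (ℕ.*-monoˡ-≤ n 1≤n) ⟩
  4 *ℕ (n *ℕ n)      ∎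
  where
  open ℕ.≤-Reasoning
  double : ∀ n → n +ℕ n ≡ 2 *ℕ (1 *ℕ n)
  double = ℕ-solve-∀

^2≡ : ∀ x → x ^ℕ 2 ≡ x *ℕ x
^2≡ x = cong (x *ℕ_) (ℕ.*-identityʳ x)

-- Squaring makes the exponent 2n² - (n+1)/2 integral and turns the constant 4 into 16.
product-square-bound : ∀ q n T S .{{_ : ℕ.NonZero q}} → 1 ≤ n →
  q ^ℕ n *ℕ T ≤ 4 *ℕ (q ^ℕ (n *ℕ n) *ℕ q ^ℕ (n *ℕ n) *ℕ S) →
  T ^ℕ 2 ≤ 16 *ℕ (S ^ℕ 2 *ℕ q ^ℕ (4 *ℕ (n *ℕ n) ∸ (n +ℕ 1)))
product-square-bound q n T S 1≤n qⁿT≤ = ℕ.*-cancelˡ-≤ (q ^ℕ (n +ℕ n)) (begin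
  q ^ℕ (n +ℕ n) *ℕ T ^ℕ 2
    ≡⟨ cong₂ _*ℕ_ (ℕ.^-distribˡ-+-* q n n) (^2≡ T) ⟩
  qⁿ *ℕ qⁿ *ℕ (T *ℕ T)
    ≡⟨ ℕ.[m*n]*[o*p]≡[m*o]*[n*p] qⁿ qⁿ T T ⟩
  (qⁿ *ℕ T) *ℕ (qⁿ *ℕ T)
    ≤⟨ ℕ.*-mono-≤ qⁿT≤ qⁿT≤ ⟩
  (4 *ℕ (Q *ℕ Q *ℕ S)) *ℕ (4 *ℕ (Q *ℕ Q *ℕ S))
    ≡⟨ collect Q S ⟩
  16 *ℕ (S *ℕ S *ℕ (Q *ℕ Q *ℕ (Q *ℕ Q)))
    ≡⟨ cong₂ (λ x y → 16 *ℕ (x *ℕ y)) (sym (^2≡ S)) Q⁴≡ ⟩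
  16 *ℕ (S ^ℕ 2 *ℕ (q ^ℕ (n +ℕ 1) *ℕ E))
    -- Raising `q ^ℕ (n +ℕ 1)` to `q ^ℕ (n +ℕ n)` creates exactly the factor on the left, which then
    -- cancels.
    ≤⟨ ℕ.*-monoʳ-≤ 16 (ℕ.*-monoʳ-≤ (S ^ℕ 2) (ℕ.*-monoˡ-≤ E (ℕ.^-monoʳ-≤ q (ℕ.+-monoʳ-≤ n 1≤n)))) ⟩
  16 *ℕ (S ^ℕ 2 *ℕ (q ^ℕ (n +ℕ n) *ℕ E))
    ≡⟨ pull (q ^ℕ (n +ℕ n)) (S ^ℕ 2) E ⟩
  q ^ℕ (n +ℕ n) *ℕ (16 *ℕ (S ^ℕ 2 *ℕ E))  ∎)
  where
  open ℕ.≤-Reasoning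
  instance
    q^-nonZero : ℕ.NonZero (q ^ℕ (n +ℕ n))
    q^-nonZero = ℕ.m^n≢0 q (n +ℕ n)
  qⁿ Q E : ℕ
  qⁿ = q ^ℕ n
  Q = q ^ℕ (n *ℕ n)
  E = q ^ℕ (4 *ℕ (n *ℕ n) ∸ (n +ℕ 1))

  collect : ∀ Q S → (4 *ℕ (Q *ℕ Q *ℕ S)) *ℕ (4 *ℕ (Q *ℕ Q *ℕ S)) ≡ 16 *ℕ (S *ℕ S *ℕ (Q *ℕ Q *ℕ (Q *ℕ Q)))
  collect = ℕ-solve-∀
  pull : ∀ a b c → 16 *ℕ (b *ℕ (a *ℕ c)) ≡ a *ℕ (16 *ℕ (b *ℕ c))
  pull = ℕ-solve-∀
  quadruple : ∀ m → m +ℕ m +ℕ (m +ℕ m) ≡ 4 *ℕ m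
  quadruple = ℕ-solve-∀

  Q⁴≡ : Q *ℕ Q *ℕ (Q *ℕ Q) ≡ q ^ℕ (n +ℕ 1) *ℕ E
  Q⁴≡ = begin-equality
    Q *ℕ Q *ℕ (Q *ℕ Q)
      ≡⟨ cong₂ _*ℕ_ (ℕ.^-distribˡ-+-* q (n *ℕ n) (n *ℕ n)) (ℕ.^-distribˡ-+-* q (n *ℕ n) (n *ℕ n)) ⟨
    q ^ℕ (n *ℕ n +ℕ n *ℕ n) *ℕ q ^ℕ (n *ℕ n +ℕ n *ℕ n)
      ≡⟨ ℕ.^-distribˡ-+-* q (n *ℕ n +ℕ n *ℕ n) (n *ℕ n +ℕ n *ℕ n) ⟨
    q ^ℕ (n *ℕ n +ℕ n *ℕ n +ℕ (n *ℕ n +ℕ n *ℕ n))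
      ≡⟨ cong (q ^ℕ_) (quadruple (n *ℕ n)) ⟩
    q ^ℕ (4 *ℕ (n *ℕ n))
      ≡⟨ cong (q ^ℕ_) (ℕ.m+[n∸m]≡n (n+1≤4n² 1≤n)) ⟨
    q ^ℕ (n +ℕ 1 +ℕ (4 *ℕ (n *ℕ n) ∸ (n +ℕ 1)))
      ≡⟨ ℕ.^-distribˡ-+-* q (n +ℕ 1) _ ⟩
    q ^ℕ (n +ℕ 1) *ℕ E  ∎

-- The exponent is twice 3n² - (n+1)/2. Splitting off the square of q^(n²) leaves the power that
-- also occurs in `product-square-bound`, so the two can be compared.
q^6n²-split : ∀ q {n} → 1 ≤ n →
  q ^ℕ (6 *ℕ (n *ℕ n) ∸ (n +ℕ 1)) ≡ q ^ℕ (n *ℕ n) *ℕ q ^ℕ (n *ℕ n) *ℕ q ^ℕ (4 *ℕ (n *ℕ n) ∸ (n +ℕ 1))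
q^6n²-split q {n} 1≤n = begin
  q ^ℕ (6 *ℕ (n *ℕ n) ∸ (n +ℕ 1))
    ≡⟨ cong (λ m → q ^ℕ (m ∸ (n +ℕ 1))) (split (n *ℕ n)) ⟩
  q ^ℕ (n *ℕ n +ℕ n *ℕ n +ℕ 4 *ℕ (n *ℕ n) ∸ (n +ℕ 1))
    ≡⟨ cong (q ^ℕ_) (ℕ.+-∸-assoc (n *ℕ n +ℕ n *ℕ n) (n+1≤4n² 1≤n)) ⟩
  q ^ℕ (n *ℕ n +ℕ n *ℕ n +ℕ (4 *ℕ (n *ℕ n) ∸ (n +ℕ 1)))
    ≡⟨ ℕ.^-distribˡ-+-* q (n *ℕ n +ℕ n *ℕ n) _ ⟩
  q ^ℕ (n *ℕ n +ℕ n *ℕ n) *ℕ q ^ℕ (4 *ℕ (n *ℕ n) ∸ (n +ℕ 1))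
    ≡⟨ cong (_*ℕ q ^ℕ (4 *ℕ (n *ℕ n) ∸ (n +ℕ 1))) (ℕ.^-distribˡ-+-* q (n *ℕ n) (n *ℕ n)) ⟩
  q ^ℕ (n *ℕ n) *ℕ q ^ℕ (n *ℕ n) *ℕ q ^ℕ (4 *ℕ (n *ℕ n) ∸ (n +ℕ 1))  ∎
  where
  open ≡-Reasoning
  split : ∀ m → 6 *ℕ m ≡ m +ℕ m +ℕ 4 *ℕ m
  split = ℕ-solve-∀

size-nonZero : (F : FiniteField) → ℕ.NonZero (FiniteField.size F)
size-nonZero F with FiniteField.elements F | FiniteField.complete F (FiniteField.0# F)
... | _ ∷ _ | _ = _

sumProd-bound : (n : ℕ) → 1 ≤ n → (F : FiniteField) (A B C : MSubset F n) → let q = FiniteField.size F in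
  (q ^ℕ (n *ℕ n) ≤ 4 *ℕ card F (sumProd F A B C))
  ⊎ ((card F A *ℕ card F B *ℕ card F C) ^ℕ 2 ≤ 16 *ℕ (card F (sumProd F A B C) ^ℕ 2 *ℕ q ^ℕ (4 *ℕ (n *ℕ n) ∸ (n +ℕ 1))))
sumProd-bound n 1≤n F A B C with 2 *ℕ card F (sumProd F A B C) ℕ.≤? FiniteField.size F ^ℕ (n *ℕ n)
... | yes 2S≤Q = inj₂ (product-square-bound (FiniteField.size F) n _ (card F (sumProd F A B C)) {{size-nonZero F}} 1≤n
                        (SumProduct.card-product-bound F n A B C 2S≤Q))
-- The factor 2 is relaxed to 4 so that a single constant `¼` serves both alternatives.
... | no  2S≰Q = inj₁ (ℕ.≤-trans (ℕ.<⇒≤ (ℕ.≰⇒> 2S≰Q)) (ℕ.*-monoˡ-≤ (card F (sumProd F A B C)) (ℕ.m≤m+n 2 2)))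

-- Rational constants and the final statement.

ℕ→ℚ : ℕ → ℚ
ℕ→ℚ m = + m / 1

-- The operation `/` normalises by a gcd. In the unnormalised rationals the fraction has explicit
-- numerator and denominator, so arithmetic facts can be read off from the integers.
toℚᵘ-ℕ→ℚ : ∀ m → ℚ.toℚᵘ (ℕ→ℚ m) ℚᵘ.≃ ℚᵘ.mkℚᵘ (+ m) 0
toℚᵘ-ℕ→ℚ m = ℚ.toℚᵘ-fromℚᵘ (ℚᵘ.mkℚᵘ (+ m) 0)

ℕ→ℚ-* : ∀ m k → ℕ→ℚ (m *ℕ k) ≡ ℕ→ℚ m * ℕ→ℚ k
ℕ→ℚ-* m k = ℚ.toℚᵘ-injective (begin-equality
  ℚ.toℚᵘ (ℕ→ℚ (m *ℕ k))                      ≃⟨ toℚᵘ-ℕ→ℚ (m *ℕ k) ⟩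
  ℚᵘ.mkℚᵘ (+ (m *ℕ k)) 0                     ≃⟨ ℚᵘ.≃-reflexive (cong (λ i → ℚᵘ.mkℚᵘ i 0) (ℤ.pos-* m k)) ⟩
  ℚᵘ.mkℚᵘ (+ m) 0 ℚᵘ.* ℚᵘ.mkℚᵘ (+ k) 0       ≃⟨ ℚᵘ.*-cong (toℚᵘ-ℕ→ℚ m) (toℚᵘ-ℕ→ℚ k) ⟨
  ℚ.toℚᵘ (ℕ→ℚ m) ℚᵘ.* ℚ.toℚᵘ (ℕ→ℚ k)         ≃⟨ ℚ.toℚᵘ-homo-* (ℕ→ℚ m) (ℕ→ℚ k) ⟨
  ℚ.toℚᵘ (ℕ→ℚ m * ℕ→ℚ k)                     ∎)
  where open ℚᵘ.≤-Reasoning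

ℕ→ℚ-mono-≤ : ∀ {m k} → m ≤ k → ℕ→ℚ m ≤ℚ ℕ→ℚ k
ℕ→ℚ-mono-≤ {m} {k} m≤k = ℚ.toℚᵘ-cancel-≤ (begin
  ℚ.toℚᵘ (ℕ→ℚ m)    ≃⟨ toℚᵘ-ℕ→ℚ m ⟩
  ℚᵘ.mkℚᵘ (+ m) 0   ≤⟨ ℚᵘ.*≤* (ℤ.*-monoʳ-≤-nonNeg (+ 1) (ℤ.+≤+ m≤k)) ⟩
  ℚᵘ.mkℚᵘ (+ k) 0   ≃⟨ toℚᵘ-ℕ→ℚ k ⟨
  ℚ.toℚᵘ (ℕ→ℚ k)    ∎)
  where open ℚᵘ.≤-Reasoning

ℕ→ℚ-nonNeg : ∀ m → ℚ.NonNegative (ℕ→ℚ m)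
ℕ→ℚ-nonNeg m = ℚ.nonNegative (ℕ→ℚ-mono-≤ {0} {m} ℕ.z≤n)

ℕ→ℚ-pos : ∀ m .{{_ : ℕ.NonZero m}} → ℚ.Positive (ℕ→ℚ m)
ℕ→ℚ-pos m = ℚ.positive (ℚ.<-≤-trans (ℚ.positive⁻¹ (ℕ→ℚ 1)) (ℕ→ℚ-mono-≤ {1} {m} (ℕ.>-nonZero⁻¹ m)))

scale-≤ : ∀ c k .{{_ : ℚ.NonNegative c}} → c * ℕ→ℚ k ≡ ℚ.1ℚ → ∀ {x} y → x ≤ℚ ℕ→ℚ (k *ℕ y) → c * x ≤ℚ ℕ→ℚ y
scale-≤ c k ck≡1 {x} y x≤ky = begin
  c * x                    ≤⟨ ℚ.*-monoˡ-≤-nonNeg c x≤ky ⟩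
  c * ℕ→ℚ (k *ℕ y)         ≡⟨ cong (c *_) (ℕ→ℚ-* k y) ⟩
  c * (ℕ→ℚ k * ℕ→ℚ y)      ≡⟨ ℚ.*-assoc c (ℕ→ℚ k) (ℕ→ℚ y) ⟨
  c * ℕ→ℚ k * ℕ→ℚ y        ≡⟨ cong (_* ℕ→ℚ y) ck≡1 ⟩
  ℚ.1ℚ * ℕ→ℚ y             ≡⟨ ℚ.*-identityˡ (ℕ→ℚ y) ⟩
  ℕ→ℚ y                    ∎
  where open ℚ.≤-Reasoning

-- No sign condition on `x` is required: if `y` were below `x`, nonnegativity of `y` would already
-- make `x` positive.
square-cancel-≤ : ∀ {x y} .{{_ : ℚ.NonNegative y}} → x * x ≤ℚ y * y → x ≤ℚ y
square-cancel-≤ {x} {y} xx≤yy with x ℚ.≤? y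
... | yes x≤y = x≤y
... | no  x≰y = contradiction (ℚ.<-≤-trans yy<xx xx≤yy) (ℚ.<-irrefl refl)
  where
  y<x : y <ℚ x
  y<x = ℚ.≰⇒> x≰y
  0<x : 0ℚ <ℚ x
  0<x = ℚ.≤-<-trans (ℚ.nonNegative⁻¹ y) y<x
  yy<xx : y * y <ℚ x * x
  yy<xx = ℚ.≤-<-trans (ℚ.*-monoˡ-≤-nonNeg y (ℚ.<⇒≤ y<x)) (ℚ.*-monoˡ-<-pos x {{ℚ.positive 0<x}} y<x)

¼ : ℚ
¼ = + 1 / 4

¼*4≡1 : ¼ * ℕ→ℚ 4 ≡ ℚ.1ℚ
¼*4≡1 = refl

¼*¼*16≡1 : ¼ * ¼ * ℕ→ℚ 16 ≡ ℚ.1ℚ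
¼*¼*16≡1 = refl

-- The two hypotheses enclose the square of `T`; cancelling `E` and taking square roots of K²Q² ≤
-- (4S)² removes it.
K*Q≤4S : ∀ K Q T S E .{{_ : ℕ.NonZero E}} → (K * K) * ℕ→ℚ (Q *ℕ Q *ℕ E) ≤ℚ ℕ→ℚ (T ^ℕ 2) →
         T ^ℕ 2 ≤ 16 *ℕ (S ^ℕ 2 *ℕ E) → K * ℕ→ℚ Q ≤ℚ ℕ→ℚ (4 *ℕ S)
K*Q≤4S K Q T S E lower upper =
  square-cancel-≤ {{ℕ→ℚ-nonNeg (4 *ℕ S)}} (ℚ.*-cancelʳ-≤-pos (ℕ→ℚ E) {{ℕ→ℚ-pos E}} (begin
  K * ℕ→ℚ Q * (K * ℕ→ℚ Q) * ℕ→ℚ E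
    ≡⟨ cong (_* ℕ→ℚ E) (ℚ-interchange K (ℕ→ℚ Q) K (ℕ→ℚ Q)) ⟩
  K * K * (ℕ→ℚ Q * ℕ→ℚ Q) * ℕ→ℚ E
    ≡⟨ ℚ.*-assoc (K * K) _ _ ⟩
  K * K * (ℕ→ℚ Q * ℕ→ℚ Q * ℕ→ℚ E)
    ≡⟨ cong (K * K *_) (trans (ℕ→ℚ-* (Q *ℕ Q) E) (cong (_* ℕ→ℚ E) (ℕ→ℚ-* Q Q))) ⟨
  K * K * ℕ→ℚ (Q *ℕ Q *ℕ E)
    ≤⟨ lower ⟩
  ℕ→ℚ (T ^ℕ 2)
    ≤⟨ ℕ→ℚ-mono-≤ upper ⟩
  ℕ→ℚ (16 *ℕ (S ^ℕ 2 *ℕ E))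
    ≡⟨ cong ℕ→ℚ (trans (cong (λ x → 16 *ℕ (x *ℕ E)) (^2≡ S)) (square S E)) ⟩
  ℕ→ℚ (4 *ℕ S *ℕ (4 *ℕ S) *ℕ E)
    ≡⟨ trans (ℕ→ℚ-* (4 *ℕ S *ℕ (4 *ℕ S)) E) (cong (_* ℕ→ℚ E) (ℕ→ℚ-* (4 *ℕ S) (4 *ℕ S))) ⟩
  ℕ→ℚ (4 *ℕ S) * ℕ→ℚ (4 *ℕ S) * ℕ→ℚ E  ∎))
  where
  open ℚ.≤-Reasoning
  square : ∀ S E → 16 *ℕ (S *ℕ S *ℕ E) ≡ 4 *ℕ S *ℕ (4 *ℕ S) *ℕ E
  square = ℕ-solve-∀

⊓1-positive : ∀ {K} → 0ℚ <ℚ K → ℚ.Positive (K ℚ.⊓ ℚ.1ℚ)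
⊓1-positive {K} 0<K with ℚ.⊓-sel K ℚ.1ℚ
... | inj₁ eq = subst ℚ.Positive (sym eq) (ℚ.positive 0<K)
... | inj₂ eq = subst ℚ.Positive (sym eq) _

¼*⊓1-positive : ∀ {K} → 0ℚ <ℚ K → ℚ.Positive (¼ * (K ℚ.⊓ ℚ.1ℚ))
¼*⊓1-positive {K} 0<K = ℚ.pos*pos⇒pos ¼ (K ℚ.⊓ ℚ.1ℚ) {{⊓1-positive 0<K}}

sumProd-lower-bound : (n : ℕ) → 1 ≤ n → (F : FiniteField) (A B C : MSubset F n) →
  (¼ * ℕ→ℚ (FiniteField.size F ^ℕ (n *ℕ n)) ≤ℚ ℕ→ℚ (card F (sumProd F A B C)))
  ⊎ ((¼ * ¼) * ℕ→ℚ ((card F A *ℕ card F B *ℕ card F C) ^ℕ 2)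
     ≤ℚ ℕ→ℚ (card F (sumProd F A B C) ^ℕ 2 *ℕ FiniteField.size F ^ℕ (4 *ℕ (n *ℕ n) ∸ (n +ℕ 1))))
sumProd-lower-bound n 1≤n F A B C = Sum.map
  (λ Q≤4S → scale-≤ ¼ 4 ¼*4≡1 S (ℕ→ℚ-mono-≤ Q≤4S))
  (λ T²≤16S² → scale-≤ (¼ * ¼) 16 ¼*¼*16≡1 (S ^ℕ 2 *ℕ E) (ℕ→ℚ-mono-≤ T²≤16S²))
  (sumProd-bound n 1≤n F A B C)
  where
  S E : ℕ
  S = card F (sumProd F A B C)
  E = FiniteField.size F ^ℕ (4 *ℕ (n *ℕ n) ∸ (n +ℕ 1))

-- Each alternative of `sumProd-bound` limits the constant separately: the first allows 1 and the
-- second `K`, both before the division by 4. Their minimum covers both cases.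
sumProd-large : (n : ℕ) → 1 ≤ n → (K : ℚ) (F : FiniteField) (A B C : MSubset F n) →
  (K * K) * ℕ→ℚ (FiniteField.size F ^ℕ (6 *ℕ (n *ℕ n) ∸ (n +ℕ 1))) ≤ℚ ℕ→ℚ ((card F A *ℕ card F B *ℕ card F C) ^ℕ 2) →
  ¼ * (K ℚ.⊓ ℚ.1ℚ) * ℕ→ℚ (FiniteField.size F ^ℕ (n *ℕ n)) ≤ℚ ℕ→ℚ (card F (sumProd F A B C))
sumProd-large n 1≤n K F A B C K²≤P² =
  subst (_≤ℚ ℕ→ℚ S) (sym (ℚ.*-assoc ¼ (K ℚ.⊓ ℚ.1ℚ) (ℕ→ℚ Q))) (scale-≤ ¼ 4 ¼*4≡1 S (cases (sumProd-bound n 1≤n F A B C)))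
  where
  q Q S P E : ℕ
  q = FiniteField.size F
  Q = q ^ℕ (n *ℕ n)
  S = card F (sumProd F A B C)
  P = card F A *ℕ card F B *ℕ card F C
  E = q ^ℕ (4 *ℕ (n *ℕ n) ∸ (n +ℕ 1))

  cases : Q ≤ 4 *ℕ S ⊎ P ^ℕ 2 ≤ 16 *ℕ (S ^ℕ 2 *ℕ E) → (K ℚ.⊓ ℚ.1ℚ) * ℕ→ℚ Q ≤ℚ ℕ→ℚ (4 *ℕ S)
  cases (inj₁ Q≤4S) = ℚ.≤-trans (ℚ.*-monoʳ-≤-nonNeg (ℕ→ℚ Q) {{ℕ→ℚ-nonNeg Q}} (ℚ.p⊓q≤q K ℚ.1ℚ))
    (ℚ.≤-trans (ℚ.≤-reflexive (ℚ.*-identityˡ (ℕ→ℚ Q))) (ℕ→ℚ-mono-≤ Q≤4S))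
  cases (inj₂ P²≤16S²) = ℚ.≤-trans (ℚ.*-monoʳ-≤-nonNeg (ℕ→ℚ Q) {{ℕ→ℚ-nonNeg Q}} (ℚ.p⊓q≤p K ℚ.1ℚ))
    (K*Q≤4S K Q P S E {{ℕ.m^n≢0 q (4 *ℕ (n *ℕ n) ∸ (n +ℕ 1)) {{size-nonZero F}}}}
      (subst (λ x → K * K * ℕ→ℚ x ≤ℚ ℕ→ℚ (P ^ℕ 2)) (q^6n²-split q 1≤n) K²≤P²) P²≤16S²)

-- A lower bound by a minimum is the same as a lower bound by one of its two terms, hence the
-- disjunction. Inequalities involving (n+1)/2 are squared, an equivalence because both sides are
-- nonnegative. The constants obtained do not even depend on `n`.
theorem1p5 : (n : ℕ) → 1 ≤ n →
    (Σ ℚ λ c → (0ℚ <ℚ c) ×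
    ((F : FiniteField) → (A B C : MSubset F n) →
    ((c *  ((+ (FiniteField.size F ^ℕ (n *ℕ n))) / 1)) ≤ℚ ((+ card F (sumProd F A B C)) / 1))
    ⊎ ((c * c) * ((+ ((card F A *ℕ card F B *ℕ card F C) ^ℕ 2)) / 1)
    ≤ℚ ((+ ((card F (sumProd F A B C) ^ℕ 2) *ℕ (FiniteField.size F ^ℕ ((4 *ℕ (n *ℕ n)) ∸ (n +ℕ 1))))) / 1))))
    × ((K : ℚ) → 0ℚ <ℚ K → Σ ℚ λ c′ → (0ℚ <ℚ c′) ×
    ((F : FiniteField) → (A B C : MSubset F n) →
    ((K * K) * ((+ (FiniteField.size F ^ℕ ((6 *ℕ (n *ℕ n)) ∸ (n +ℕ 1)))) / 1)
    ≤ℚ ((+ ((card F A *ℕ card F B *ℕ card F C) ^ℕ 2)) / 1)) →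
    (c′ * ((+ (FiniteField.size F ^ℕ (n *ℕ n))) / 1)) ≤ℚ ((+ card F (sumProd F A B C)) / 1)))
theorem1p5 n 1≤n =
  (¼ , ℚ.positive⁻¹ ¼ , sumProd-lower-bound n 1≤n) ,
  λ K 0<K → ¼ * (K ℚ.⊓ ℚ.1ℚ) , ℚ.positive⁻¹ (¼ * (K ℚ.⊓ ℚ.1ℚ)) {{¼*⊓1-positive 0<K}} , sumProd-large n 1≤n K
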